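{- Let $F$ be a graph. Then $\mathrm{rex}(n,K_3,F)=O(n)$ (as $n\to\infty$, with $F$ fixed) if and only if $F$ is an extended friendship graph.
   Context: All graphs are finite and simple. $\mathcal{N}(H,G)$ denotes the number of (not necessarily induced) copies of $H$ in $G$. A graph is $F$-free if it does not contain $F$ as a (not necessarily induced) subgraph. For graphs $H,F$ and a positive integer $n$, $\mathrm{rex}(n,H,F):=\max\{\mathcal{N}(H,G): G \text{ is an } F\text{ -free regular } n\text{ -vertex graph}\}$. An extended friendship graph is a graph in which every cycle is a triangle and there is a vertex $v$ such that every pair of triangles intersect in $v$; equivalently, its 2-core is empty or a friendship graph (one or more triangles all sharing one common vertex and otherwise vertex-disjoint). -}

module Defs where

open import Data.Bool using (Bool; true; false)
open import Data.Fin using (Fin; zero; suc; inject₁; fromℕ; _≟_)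
open import Data.Fin.Properties using (any?; all?)
open import Data.Fin.Subset using (Subset; _∈_; _∉_; _∩_; ∁; ⁅_⁆; ∣_∣)
open import Data.Fin.Subset.Properties
  using (_∈?_; x∈⁅x⁆; x∈⁅y⁆⇔x≡y; x∈p⇒x∉∁p; x∈∁p⇒x∉p; x∉p⇒x∈∁p)
open import Data.List using (List; []; _∷_; allFin; cartesianProductWith; deduplicate; filter; length; map; mapMaybe)
import Data.List.Extrema as Extrema
open import Data.List.Membership.Propositional using () renaming (_∈_ to _∈ₗ_; lose to loseₗ)
open import Data.List.Membership.Propositional.Properties using (∈-cartesianProductWith⁺; ∈-allFin)
import Data.List.Relation.Unary.Any as Any
import Data.Maybe
open import Data.Nat using (ℕ; zero; suc; _*_; _≤_)
import Data.Nat as ℕ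
import Data.Nat.Properties as ℕₚ
open import Data.Product using (∃; ∃-syntax; _×_; _,_)
open import Data.Product.Properties using () renaming (≡-dec to ×-≡-dec)
open import Data.Sum using (_⊎_)
open import Data.Vec using (Vec; []; _∷_; lookup; tabulate)
open import Data.Vec.Properties using (lookup∘tabulate) renaming (≡-dec to Vec-≡-dec)
open import Function using (_∘_; Equivalence)
open import Function.Definitions using (Injective)
open import Relation.Binary.Definitions using (DecidableEquality)
open import Relation.Binary.PropositionalEquality using (_≡_; _≢_; refl; sym; trans; subst; subst₂)
open import Relation.Nullary using (¬_; Dec; does; ¬?)
open import Relation.Nullary.Decidable using (map′; _×-dec_; _→-dec_; dec⇒maybe)

import Data.Bool.Properties as Bool

Neighbourhoods : ℕ → Set
Neighbourhoods n = Vec (Subset n) n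

IsSimple : ∀ {n} → Neighbourhoods n → Set
IsSimple N = (∀ i j → j ∈ lookup N i → i ∈ lookup N j) × (∀ i → i ∉ lookup N i)

record Graph (n : ℕ) : Set where
  constructor mkGraph
  field
    neighbourhoods : Neighbourhoods n
    isSimple       : IsSimple neighbourhoods

  neighbours : Fin n → Subset n
  neighbours = lookup neighbourhoods

  Adj : Fin n → Fin n → Set
  Adj i j = j ∈ neighbours i

  degree : Fin n → ℕ
  degree i = ∣ neighbours i ∣

open Graph public

adj? : ∀ {n} (G : Graph n) i j → Dec (Adj G i j)
adj? G i j = j ∈? neighbours G i

Regular : ∀ {n} → Graph n → Set
Regular G = ∀ i j → degree G i ≡ degree G j

complete : ∀ n → Graph n
complete n = mkGraph others (symmetric , irreflexive)
  where
  others : Neighbourhoods n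
  others = tabulate (λ i → ∁ ⁅ i ⁆)

  others-lookup : ∀ i → lookup others i ≡ ∁ ⁅ i ⁆
  others-lookup = lookup∘tabulate (λ i → ∁ ⁅ i ⁆)

  symmetric : ∀ i j → j ∈ lookup others i → i ∈ lookup others j
  symmetric i j j∈ = subst (i ∈_) (sym (others-lookup j))
    (x∉p⇒x∈∁p λ i∈⁅j⁆ → x∈∁p⇒x∉p (subst (j ∈_) (others-lookup i) j∈)
      (Equivalence.from x∈⁅y⁆⇔x≡y (sym (Equivalence.to x∈⁅y⁆⇔x≡y i∈⁅j⁆))))

  irreflexive : ∀ i → i ∉ lookup others i
  irreflexive i i∈ = x∈p⇒x∉∁p (x∈⁅x⁆ i) (subst (i ∈_) (others-lookup i) i∈)

K₃ : Graph 3
K₃ = complete 3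

IsEmbedding : ∀ {h n} → Graph h → Graph n → (Fin h → Fin n) → Set
IsEmbedding H G φ = Injective _≡_ _≡_ φ × (∀ i j → Adj H i j → Adj G (φ i) (φ j))

Contains : ∀ {h n} → Graph h → Graph n → Set
Contains H G = ∃ (IsEmbedding H G)

Free : ∀ {h n} → Graph h → Graph n → Set
Free F G = ¬ Contains F G

vectors : ∀ {A : Set} → List A → ∀ m → List (Vec A m)
vectors xs zero    = [] ∷ []
vectors xs (suc m) = cartesianProductWith _∷_ xs (vectors xs m)

∈-vectors : ∀ {A : Set} {xs : List A} → (∀ x → x ∈ₗ xs) →
            ∀ {m} (v : Vec A m) → v ∈ₗ vectors xs m
∈-vectors all []      = Any.here refl
∈-vectors all (x ∷ v) = ∈-cartesianProductWith⁺ _∷_ (all x) (∈-vectors all v)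

isSimple? : ∀ {n} (N : Neighbourhoods n) → Dec (IsSimple N)
isSimple? N =
  all? (λ i → all? (λ j → (j ∈? lookup N i) →-dec (i ∈? lookup N j)))
  ×-dec all? (λ i → ¬? (i ∈? lookup N i))

regular? : ∀ {n} (G : Graph n) → Dec (Regular G)
regular? G = all? (λ i → all? (λ j → degree G i ℕ.≟ degree G j))

isEmbedding? : ∀ {h n} (H : Graph h) (G : Graph n) φ → Dec (IsEmbedding H G φ)
isEmbedding? H G φ =
  map′ (λ inj {i} {j} → inj i j) (λ inj i j → inj {i} {j})
    (all? (λ i → all? (λ j → (φ i ≟ φ j) →-dec (i ≟ j))))
  ×-dec all? (λ i → all? (λ j → adj? H i j →-dec adj? G (φ i) (φ j)))

contains? : ∀ {h n} (H : Graph h) (G : Graph n) → Dec (Contains H G)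
contains? {h} {n} H G =
  map′ (λ p → let v , emb = Any.satisfied p in lookup v , emb) complete-search
    (Any.any? (λ v → isEmbedding? H G (lookup v)) (vectors (allFin n) h))
  where
  complete-search : Contains H G →
    Any.Any (λ v → IsEmbedding H G (lookup v)) (vectors (allFin n) h)
  complete-search (φ , inj , hom) = loseₗ (∈-vectors ∈-allFin (tabulate φ))
    ( (λ {i} {j} eq → inj (trans (sym (φ≗ i)) (trans eq (φ≗ j))))
    , (λ i j ij → subst₂ (Adj G) (sym (φ≗ i)) (sym (φ≗ j)) (hom i j ij)) )
    where
    φ≗ : ∀ i → lookup (tabulate φ) i ≡ φ i
    φ≗ = lookup∘tabulate φ

free? : ∀ {h n} (F : Graph h) (G : Graph n) → Dec (Free F G)
free? F G = ¬? (contains? F G)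

graphs : ∀ n → List (Graph n)
graphs n = mapMaybe (λ N → Data.Maybe.map (mkGraph N) (dec⇒maybe (isSimple? N)))
                    (vectors (vectors (true ∷ false ∷ []) n) n)

-- A subgraph of a graph on Fin n: its vertices, and the neighbours of every
-- element of Fin n inside the subgraph (empty off its vertex set).
Subgraph : ℕ → Set
Subgraph n = Subset n × Neighbourhoods n

_≟ˢ_ : ∀ {n} → DecidableEquality (Subgraph n)
_≟ˢ_ = ×-≡-dec (Vec-≡-dec Bool._≟_) (Vec-≡-dec (Vec-≡-dec Bool._≟_))

image : ∀ {h n} → Graph h → (Fin h → Fin n) → Subgraph n
image H φ =
    tabulate (λ x → does (any? (λ i → φ i ≟ x)))
  , tabulate (λ x → tabulate (λ y →
      does (any? (λ i → any? (λ j → adj? H i j ×-dec (φ i ≟ x) ×-dec (φ j ≟ y))))))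

-- The subgraphs of G isomorphic to H are exactly the images of embeddings of H;
-- embeddings differing by an automorphism of H have the same image, which is
-- listed once.
copies : ∀ {h n} → Graph h → Graph n → List (Subgraph n)
copies {h} {n} H G =
  deduplicate _≟ˢ_
    (map (image H ∘ lookup)
      (filter (λ v → isEmbedding? H G (lookup v)) (vectors (allFin n) h)))

𝒩 : ∀ {h n} → Graph h → Graph n → ℕ
𝒩 H G = length (copies H G)

-- The maximum over the empty family is 0.  When F has an edge the family is
-- nonempty, since it contains the edgeless graph on Fin n.
rex : ∀ {h f} → ℕ → Graph h → Graph f → ℕ
rex n H F = max 0 (map (𝒩 H) (filter (λ G → free? F G ×-dec regular? G) (graphs n)))
  where open Extrema ℕₚ.≤-totalOrder using (max)

infix 4 _=O_

_=O_ : (ℕ → ℕ) → (ℕ → ℕ) → Set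
f =O g = ∃[ C ] ∃[ n₀ ] (∀ n → n₀ ≤ n → f n ≤ C * g n)

-- The sequence c 0, …, c m is a cycle of length suc m in G.
record IsCycle {k} (G : Graph k) {m} (c : Fin (suc m) → Fin k) : Set where
  field
    length≥3  : 3 ≤ suc m
    injective : Injective _≡_ _≡_ c
    step      : ∀ (i : Fin m) → Adj G (c (inject₁ i)) (c (suc i))
    close     : Adj G (c (fromℕ m)) (c zero)

IsTriangle : ∀ {k} → Graph k → Subset k → Set
IsTriangle G T = ∣ T ∣ ≡ 3 × (∀ i j → i ∈ T → j ∈ T → i ≢ j → Adj G i j)

-- The graph with no vertices has an empty 2-core, hence is an extended
-- friendship graph although it has no vertex to serve as the centre.
record ExtendedFriendship {k} (G : Graph k) : Set where
  field
    cycle⇒triangle : ∀ {m} (c : Fin (suc m) → Fin k) → IsCycle G c → suc m ≡ 3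
    centre         : k ≡ 0 ⊎ (∃[ v ] (∀ T T′ → IsTriangle G T → IsTriangle G T′ →
                                      T ≢ T′ → T ∩ T′ ≡ ⁅ v ⁆))

module Submission where

-- If F is an extended friendship graph, fix k = |V(F)|.  If in a regular F-free
-- graph the link of every vertex has a vertex cover of size k, then choosing an
-- element of the cover for each corner of a triangle shows that there are at most
-- n k² triangles.  If the link of x₀ has no such cover, then all degrees exceed k
-- and any k vertices are avoided by some triangle at x₀, so F embeds with its
-- centre at x₀, one leaf or one pendant triangle at a time.
--
-- Conversely, if F has a cycle longer than a triangle, take points carrying d
-- partitions into orbits of size 3 whose incidence graph has large girth (built by
-- iterated Z₂-lifts), and join points in a common orbit: the short cycles are
-- triangles and there are nd/3 of them.  If F has two disjoint triangles, a regular
-- graph with quadratically many triangles, all through one vertex, is F-free.  A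
-- graph excluded by neither family is an extended friendship graph.

open import Data.Bool using (Bool; true; false; not; _xor_)
open import Data.Bool.Properties using (not-¬)
open import Data.Empty using (⊥; ⊥-elim)
open import Data.Fin using (Fin; zero; suc; _≟_; combine; punchIn; inject₁; fromℕ; toℕ; inject≤)
open import Data.Fin.Properties
  using (any?; all?; injective⇒≤; suc-injective; 0≢1+n; combine-injective; punchIn-injective;
    punchInᵢ≢i; +↔⊎; *↔×; 1↔⊤; 2↔Bool; toℕ-injective; toℕ-inject≤; toℕ-inject₁; toℕ-fromℕ;
    toℕ<n; inject≤-injective)
open import Data.Fin.Subset using (Subset; _∈_; _∉_; _∩_; _-_; ∁; ∣_∣; ⁅_⁆) renaming (⊤ to full)
open import Data.Fin.Subset.Properties
  using (_∈?_; ∈⊤; ∣p∣≤n; ∣p─q∣≤∣p∣; anySubset?; p─q⊆p; x∈p∩q⁺; x∈p∩q⁻; x∈p∧x≢y⇒x∈p-y;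
    x∈p⇒∣p-x∣<∣p∣; x∈⁅x⁆; x∈⁅y⁆⇒x≡y; x∉p⇒x∈∁p; ⊆-antisym)
open import Data.List
  using (List; []; _∷_; map; length; allFin; filter; concatMap; cartesianProduct)
import Data.List as List
import Data.List.Extrema as Extrema
open import Data.List.Membership.Propositional
  using (find) renaming (_∈_ to _∈ₗ_; _∉_ to _∉ₗ_; lose to loseₗ)
open import Data.List.Membership.Propositional.Properties
  using (∈-map⁺; ∈-map⁻; ∈-filter⁺; ∈-filter⁻; ∈-deduplicate⁺; ∈-deduplicate⁻; ∈-lookup;
    ∈-allFin; ∈-concatMap⁺; ∈-cartesianProduct⁺)
import Data.List.Membership.Setoid.Properties as SetoidMembership
open import Data.List.Properties using (length-map; length-++; length-tabulate)
open import Data.List.Relation.Unary.All as All using (All; []; _∷_)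
import Data.List.Relation.Unary.All.Properties as Allₚ
open import Data.List.Relation.Unary.AllPairs using ([]; _∷_)
open import Data.List.Relation.Unary.Any as Any using (Any; here; there)
import Data.List.Relation.Unary.Any.Properties as Anyₚ
open import Data.List.Relation.Unary.Unique.DecPropositional.Properties using (deduplicate-!)
open import Data.List.Relation.Unary.Unique.Propositional using (Unique)
import Data.List.Relation.Unary.Unique.Propositional.Properties as Uniqueₚ
import Data.Maybe
import Data.Maybe.Relation.Unary.Any as MAny
open import Data.Nat using (ℕ; zero; suc; _+_; _*_; _^_; _≤_; _<_; z≤n; s≤s)
import Data.Nat as ℕ
import Data.Nat.Properties as ℕₚ
open import Data.Nat.Solver using (module +-*-Solver)
open import Data.Product using (Σ; ∃; _×_; _,_; proj₁; proj₂; uncurry)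
open import Data.Product.Function.NonDependent.Propositional using (_×-↔_)
open import Data.Sum using (_⊎_; inj₁; inj₂; [_,_]′)
import Data.Sum
open import Data.Sum.Function.Propositional using (_⊎-↔_)
open import Data.Unit using (⊤; tt)
open import Data.Vec using (Vec; []; _∷_; lookup; tabulate; here; there; uncons)
open import Data.Vec.Functional using () renaming (_∷_ to _◃_)
open import Data.Vec.Properties
  using (lookup∘tabulate; tabulate∘lookup; tabulate-cong; lookup⇒[]=; []=⇒lookup)
open import Function using (id; _∘_; _⇔_; mk⇔; _↔_; Inverse; mk↔ₛ′)
open import Function.Definitions using (Injective)
open import Function.Properties.Inverse using (↔-sym; ↔-trans; ↔-refl)
open import Relation.Binary.Definitions using (DecidableEquality)
open import Relation.Binary.PropositionalEquality
  using (_≡_; _≢_; refl; sym; trans; cong; cong₂; subst; subst₂; setoid)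
open import Relation.Nullary using (¬_; Dec; yes; no; does; _×-dec_; ¬?)
open import Relation.Nullary.Decidable
  using (dec⇒maybe; does-⇔; dec-true; dec-false; map′; _→-dec_; _⊎-dec_; decidable-stable)
open import Defs

-- Counting with lists and subsets

lookup-injective : ∀ {A : Set} {xs : List A} → Unique xs → Injective _≡_ _≡_ (List.lookup xs)
lookup-injective (_ ∷ _) {zero} {zero} _ = refl
lookup-injective (x≢ ∷ _) {zero} {suc j} eq = ⊥-elim (All.lookup x≢ (∈-lookup j) eq)
lookup-injective (x≢ ∷ _) {suc i} {zero} eq = ⊥-elim (All.lookup x≢ (∈-lookup i) (sym eq))
lookup-injective (_ ∷ u) {suc i} {suc j} eq = cong suc (lookup-injective u eq)

unique⊆⇒length≤ : ∀ {A : Set} {xs ys : List A} → Unique xs → (∀ {x} → x ∈ₗ xs → x ∈ₗ ys) →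
                  length xs ≤ length ys
unique⊆⇒length≤ {A} {xs} u xs⊆ys = injective⇒≤ λ {i} {j} eq →
  lookup-injective u
    (SetoidMembership.index-injective (setoid A) (position i) (position j) eq)
  where
  position : ∀ i → List.lookup xs i ∈ₗ _
  position i = xs⊆ys (∈-lookup i)

length-concatMap-≤ : ∀ {A B : Set} (f : A → List B) {s} → (∀ x → length (f x) ≤ s) →
                     ∀ xs → length (concatMap f xs) ≤ length xs * s
length-concatMap-≤ f f≤ [] = z≤n
length-concatMap-≤ f f≤ (x ∷ xs) = ℕₚ.≤-trans
  (ℕₚ.≤-reflexive (length-++ (f x)))
  (ℕₚ.+-mono-≤ (f≤ x) (length-concatMap-≤ f f≤ xs))

elements : ∀ {n} → Subset n → List (Fin n)
elements [] = []
elements (true ∷ p) = zero ∷ map suc (elements p)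
elements (false ∷ p) = map suc (elements p)

length-elements : ∀ {n} (p : Subset n) → length (elements p) ≡ ∣ p ∣
length-elements [] = refl
length-elements (true ∷ p) = cong suc (trans (length-map suc (elements p)) (length-elements p))
length-elements (false ∷ p) = trans (length-map suc (elements p)) (length-elements p)

∈-elements⁺ : ∀ {n} {p : Subset n} {x} → x ∈ p → x ∈ₗ elements p
∈-elements⁺ here = here refl
∈-elements⁺ {p = true ∷ p} (there x∈p) = there (∈-map⁺ suc (∈-elements⁺ x∈p))
∈-elements⁺ {p = false ∷ p} (there x∈p) = ∈-map⁺ suc (∈-elements⁺ x∈p)

∈-elements⁻ : ∀ {n} {p : Subset n} {x} → x ∈ₗ elements p → x ∈ p
∈-elements⁻ {p = true ∷ p} (here refl) = here
∈-elements⁻ {p = true ∷ p} (there x∈) with _ , y∈ , refl ← ∈-map⁻ suc x∈ = there (∈-elements⁻ y∈)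
∈-elements⁻ {p = false ∷ p} x∈ with _ , y∈ , refl ← ∈-map⁻ suc x∈ = there (∈-elements⁻ y∈)

elements-unique : ∀ {n} (p : Subset n) → Unique (elements p)
elements-unique [] = []
elements-unique (true ∷ p) =
  Allₚ.map⁺ (All.universal (λ _ → 0≢1+n) (elements p)) ∷
  Uniqueₚ.map⁺ suc-injective (elements-unique p)
elements-unique (false ∷ p) = Uniqueₚ.map⁺ suc-injective (elements-unique p)

-- Both inequalities come from injections between `Fin D` and the positions in `elements p`.
∣p∣≡size-of-enumeration : ∀ {n D} {p : Subset n} (e : Fin D → Fin n) → Injective _≡_ _≡_ e →
  (∀ i → e i ∈ p) → (∀ {x} → x ∈ p → ∃ λ i → e i ≡ x) → ∣ p ∣ ≡ D
∣p∣≡size-of-enumeration {n} {D} {p} e e-inj e∈p e-onto = ℕₚ.≤-antisym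
  (subst₂ _≤_ (length-elements p) refl (injective⇒≤ λ {i} {j} eq →
    lookup-injective (elements-unique p)
      (trans (sym (proj₂ (preimage i))) (trans (cong e eq) (proj₂ (preimage j))))))
  (subst (D ≤_) (length-elements p) (injective⇒≤ λ {i} {j} eq →
    e-inj (SetoidMembership.index-injective (setoid (Fin n))
      (∈-elements⁺ (e∈p i)) (∈-elements⁺ (e∈p j)) eq)))
  where
  preimage : ∀ i → ∃ λ j → e j ≡ List.lookup (elements p) i
  preimage i = e-onto (∈-elements⁻ {p = p} (∈-lookup i))

-- Copies of K₃ and their number

K₃-adj⁺ : ∀ i j → i ≢ j → Adj K₃ i j
K₃-adj⁺ i j i≢j = subst (j ∈_) (sym (lookup∘tabulate (λ x → ∁ ⁅ x ⁆) i))
  (x∉p⇒x∈∁p λ j∈ → i≢j (sym (x∈⁅y⁆⇒x≡y i j∈)))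

K₃-adj⁻ : ∀ i j → Adj K₃ i j → i ≢ j
K₃-adj⁻ i .i i~i refl = isSimple K₃ .proj₂ i i~i

Triangle : ∀ {n} → Graph n → Fin n → Fin n → Fin n → Set
Triangle G x y z = Adj G x y × Adj G y z × Adj G x z

module _ {n} (G : Graph n) where

  adj-sym : ∀ {x y} → Adj G x y → Adj G y x
  adj-sym = isSimple G .proj₁ _ _

  adj-irr : ∀ {x y} → Adj G x y → x ≢ y
  adj-irr x~x refl = isSimple G .proj₂ _ x~x

corners : ∀ {n} → Fin n → Fin n → Fin n → Vec (Fin n) 3
corners x y z = x ∷ y ∷ z ∷ []

abstract

  -- Opaque: later arguments see a triangle only through its vertices, the symmetries of its corners
  -- and membership in `copies`.
  triangle : ∀ {n} → Fin n → Fin n → Fin n → Subgraph n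
  triangle x y z = image K₃ (lookup (corners x y z))

Distinct₃ : ∀ {n} → Fin n → Fin n → Fin n → Set
Distinct₃ x y z = x ≢ y × y ≢ z × x ≢ z

corners-injective : ∀ {n} {x y z : Fin n} → Distinct₃ x y z → Injective _≡_ _≡_ (lookup (corners x y z))
corners-injective _ {zero} {zero} _ = refl
corners-injective (p , _ , _) {zero} {suc zero} eq = ⊥-elim (p eq)
corners-injective (_ , _ , r) {zero} {suc (suc zero)} eq = ⊥-elim (r eq)
corners-injective (p , _ , _) {suc zero} {zero} eq = ⊥-elim (p (sym eq))
corners-injective _ {suc zero} {suc zero} _ = refl
corners-injective (_ , q , _) {suc zero} {suc (suc zero)} eq = ⊥-elim (q eq)
corners-injective (_ , _ , r) {suc (suc zero)} {zero} eq = ⊥-elim (r (sym eq))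
corners-injective (_ , q , _) {suc (suc zero)} {suc zero} eq = ⊥-elim (q (sym eq))
corners-injective _ {suc (suc zero)} {suc (suc zero)} _ = refl

triangle-embedding : ∀ {n} (G : Graph n) {x y z} → Triangle G x y z →
                     IsEmbedding K₃ G (lookup (corners x y z))
triangle-embedding G {x} {y} {z} (xy , yz , xz) =
  corners-injective (adj-irr G xy , adj-irr G yz , adj-irr G xz) , hom
  where
  hom : ∀ i j → Adj K₃ i j → Adj G (lookup (corners x y z) i) (lookup (corners x y z) j)
  hom zero zero a = ⊥-elim (K₃-adj⁻ zero zero a refl)
  hom zero (suc zero) _ = xy
  hom zero (suc (suc zero)) _ = xz
  hom (suc zero) zero _ = adj-sym G xy
  hom (suc zero) (suc zero) a = ⊥-elim (K₃-adj⁻ (suc zero) (suc zero) a refl)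
  hom (suc zero) (suc (suc zero)) _ = yz
  hom (suc (suc zero)) zero _ = adj-sym G xz
  hom (suc (suc zero)) (suc zero) _ = adj-sym G yz
  hom (suc (suc zero)) (suc (suc zero)) a = ⊥-elim (K₃-adj⁻ (suc (suc zero)) (suc (suc zero)) a refl)

embedding-triangle : ∀ {n} (G : Graph n) (v : Vec (Fin n) 3) → IsEmbedding K₃ G (lookup v) →
  ∃ λ x → ∃ λ y → ∃ λ z → Triangle G x y z × v ≡ corners x y z
embedding-triangle G (x ∷ y ∷ z ∷ []) (_ , hom) =
  x , y , z , (edge zero (suc zero) (λ ()) , edge (suc zero) (suc (suc zero)) (λ ())
              , edge zero (suc (suc zero)) (λ ())) , refl
  where
  edge : ∀ i j → i ≢ j → Adj G (lookup (corners x y z) i) (lookup (corners x y z) j)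
  edge i j i≢j = hom i j (K₃-adj⁺ i j i≢j)

∈-corners : ∀ {n} {x y z u : Fin n} → (∃ λ i → lookup (corners x y z) i ≡ u) → u ≡ x ⊎ u ≡ y ⊎ u ≡ z
∈-corners (zero , eq) = inj₁ (sym eq)
∈-corners (suc zero , eq) = inj₂ (inj₁ (sym eq))
∈-corners (suc (suc zero) , eq) = inj₂ (inj₂ (sym eq))

vertexOf? : ∀ {n} (φ : Fin 3 → Fin n) x → Dec (∃ λ i → φ i ≡ x)
vertexOf? φ x = any? (λ i → φ i ≟ x)

edgeOf? : ∀ {n} (φ : Fin 3 → Fin n) x y → Dec (∃ λ i → ∃ λ j → Adj K₃ i j × φ i ≡ x × φ j ≡ y)
edgeOf? φ x y = any? (λ i → any? (λ j → adj? K₃ i j ×-dec (φ i ≟ x) ×-dec (φ j ≟ y)))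

-- Adjacency in `K₃` is distinctness, so for injective maps the vertices of the image already
-- determine its edges.
image-K₃-cong : ∀ {n} {φ ψ : Fin 3 → Fin n} → Injective _≡_ _≡_ φ → Injective _≡_ _≡_ ψ →
  (∀ i → ∃ λ j → ψ j ≡ φ i) → (∀ i → ∃ λ j → φ j ≡ ψ i) → image K₃ φ ≡ image K₃ ψ
image-K₃-cong {φ = φ} {ψ} φ-inj ψ-inj φ⊆ψ ψ⊆φ = cong₂ _,_
  (tabulate-cong λ x →
    does-⇔ (mk⇔ (vertex φ⊆ψ) (vertex ψ⊆φ)) (vertexOf? φ x) (vertexOf? ψ x))
  (tabulate-cong λ x → tabulate-cong λ y →
    does-⇔ (mk⇔ (edge φ-inj φ⊆ψ) (edge ψ-inj ψ⊆φ)) (edgeOf? φ x y) (edgeOf? ψ x y))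
  where
  vertex : ∀ {χ ω : Fin 3 → Fin _} → (∀ i → ∃ λ j → ω j ≡ χ i) → ∀ {x} →
           (∃ λ i → χ i ≡ x) → ∃ λ i → ω i ≡ x
  vertex χ⊆ω (i , eq) = let j , eq′ = χ⊆ω i in j , trans eq′ eq
  edge : ∀ {χ ω : Fin 3 → Fin _} → Injective _≡_ _≡_ χ → (∀ i → ∃ λ j → ω j ≡ χ i) → ∀ {x y} →
         (∃ λ i → ∃ λ j → Adj K₃ i j × χ i ≡ x × χ j ≡ y) →
         ∃ λ i → ∃ λ j → Adj K₃ i j × ω i ≡ x × ω j ≡ y
  edge {ω = ω} χ-inj χ⊆ω (i , j , i~j , refl , refl) with i′ , i-eq ← χ⊆ω i | j′ , j-eq ← χ⊆ω j =
    i′ , j′ , K₃-adj⁺ i′ j′ (λ i′≡j′ → K₃-adj⁻ i j i~j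
      (χ-inj (trans (sym i-eq) (trans (cong ω i′≡j′) j-eq)))) , i-eq , j-eq

does-≡⇒ : ∀ {P Q : Set} (P? : Dec P) (Q? : Dec Q) → does P? ≡ does Q? → P → Q
does-≡⇒ _ (yes q) _ _ = q
does-≡⇒ (no ¬p) (no _) _ p = ⊥-elim (¬p p)

abstract

  -- Compares the vertex tables of the two subgraphs at a corner; this is how triangles are told
  -- apart in the counts from below.
  ∈-triangle : ∀ {n} {x y z u v w : Fin n} → triangle x y z ≡ triangle u v w →
    ∀ i → let t = lookup (corners x y z) i in t ≡ u ⊎ t ≡ v ⊎ t ≡ w
  ∈-triangle {n} {x} {y} {z} {u} {v} {w} eq i = ∈-corners
    (does-≡⇒ (vertexOf? (lookup (corners x y z)) t) (vertexOf? (lookup (corners u v w)) t)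
      (trans (sym (lookup∘tabulate (λ s → does (vertexOf? (lookup (corners x y z)) s)) t))
        (trans (cong (λ S → lookup (proj₁ S) t) eq)
          (lookup∘tabulate (λ s → does (vertexOf? (lookup (corners u v w)) s)) t)))
      (i , refl))
    where
    t : Fin n
    t = lookup (corners x y z) i

module _ {n} {x y z : Fin n} (xyz : Distinct₃ x y z) where

  private
    distinct-sym : Distinct₃ y z x × Distinct₃ y x z
    distinct-sym = let p , q , r = xyz in
      (q , r ∘ sym , p ∘ sym) , (p ∘ sym , r , q)

  abstract

    -- Together with `triangle-swap` this generates all permutations of the corners.
    triangle-rotate : triangle x y z ≡ triangle y z x
    triangle-rotate = image-K₃-cong (corners-injective xyz) (corners-injective (proj₁ distinct-sym))
      (λ { zero → suc (suc zero) , refl ; (suc zero) → zero , refl ; (suc (suc zero)) → suc zero , refl })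
      (λ { zero → suc zero , refl ; (suc zero) → suc (suc zero) , refl ; (suc (suc zero)) → zero , refl })

    triangle-swap : triangle x y z ≡ triangle y x z
    triangle-swap = image-K₃-cong (corners-injective xyz) (corners-injective (proj₂ distinct-sym))
      (λ { zero → suc zero , refl ; (suc zero) → zero , refl ; (suc (suc zero)) → suc (suc zero) , refl })
      (λ { zero → suc zero , refl ; (suc zero) → zero , refl ; (suc (suc zero)) → suc (suc zero) , refl })

abstract

  ∈-copies⁺ : ∀ {n} (G : Graph n) {x y z} → Triangle G x y z → triangle x y z ∈ₗ copies K₃ G
  ∈-copies⁺ {n} G {x} {y} {z} t = ∈-deduplicate⁺ _≟ˢ_ (∈-map⁺ (image K₃ ∘ lookup)
    (∈-filter⁺ (λ v → isEmbedding? K₃ G (lookup v)) (∈-vectors ∈-allFin (corners x y z))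
      (triangle-embedding G t)))

  ∈-copies⁻ : ∀ {n} (G : Graph n) {T} → T ∈ₗ copies K₃ G →
              ∃ λ x → ∃ λ y → ∃ λ z → Triangle G x y z × T ≡ triangle x y z
  ∈-copies⁻ {n} G {T} T∈
    with v , v∈ , refl ← ∈-map⁻ (image K₃ ∘ lookup) (∈-deduplicate⁻ _≟ˢ_ (map (image K₃ ∘ lookup)
                       (filter (λ v → isEmbedding? K₃ G (lookup v)) (vectors (allFin n) 3))) T∈)
    with x , y , z , t , refl ← embedding-triangle G v
           (proj₂ (∈-filter⁻ (λ v → isEmbedding? K₃ G (lookup v)) {xs = vectors (allFin n) 3} v∈))
    = x , y , z , t , refl

copies-unique : ∀ {n} (G : Graph n) → Unique (copies K₃ G)
copies-unique {n} G = deduplicate-! _≟ˢ_ (map (image K₃ ∘ lookup)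
  (filter (λ v → isEmbedding? K₃ G (lookup v)) (vectors (allFin n) 3)))

-- `S x` is a vertex cover of the link of `x`, whose edges are the sides opposite `x` in triangles.
CoversTriangles : ∀ {n} → Graph n → (Fin n → List (Fin n)) → Set
CoversTriangles G S = ∀ {x y z} → Triangle G x y z → y ∈ₗ S x ⊎ z ∈ₗ S x

-- Choosing for each corner another corner in its cover gives a fixed-point-free
-- map f on the three corners; some corner x then satisfies T = {x, f x, f (f x)}.
triangles≤cover² : ∀ {n} (G : Graph n) (S : Fin n → List (Fin n)) {s} →
  (∀ x → length (S x) ≤ s) → CoversTriangles G S → 𝒩 K₃ G ≤ n * (s * s)
triangles≤cover² {n} G S {s} S≤s cover = ℕₚ.≤-trans
  (unique⊆⇒length≤ (copies-unique G) copies⊆candidates)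
  (ℕₚ.≤-trans (length-concatMap-≤ from (λ x → ℕₚ.≤-trans
    (length-concatMap-≤ (from₂ x)
      (λ y → ℕₚ.≤-trans (ℕₚ.≤-reflexive (length-map (triangle x y) (S y))) (S≤s y)) (S x))
    (ℕₚ.*-monoˡ-≤ s (S≤s x))) (allFin n))
    (ℕₚ.≤-reflexive (cong (_* (s * s)) (length-tabulate (id {A = Fin n})))))
  where
  from₂ : Fin n → Fin n → List (Subgraph n)
  from₂ x y = map (triangle x y) (S y)

  from : Fin n → List (Subgraph n)
  from x = concatMap (from₂ x) (S x)

  candidates = concatMap from (allFin n)

  candidate : ∀ {x y z} → y ∈ₗ S x → z ∈ₗ S y → triangle x y z ∈ₗ candidates
  candidate {x} {y} {z} y∈ z∈ = ∈-concatMap⁺ from (loseₗ (∈-allFin x)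
    (∈-concatMap⁺ (from₂ x) (loseₗ y∈ (∈-map⁺ (triangle x y) z∈))))

  module _ {x y z} (t : Triangle G x y z) where

    private
      xy = adj-irr G (proj₁ t)
      yz = adj-irr G (proj₁ (proj₂ t))
      xz = adj-irr G (proj₂ (proj₂ t))

    two-steps : y ∈ₗ S x → triangle x y z ∈ₗ candidates
    two-steps y∈ with cover (let a , b , c = t in b , adj-sym G c , adj-sym G a)
    ... | inj₁ z∈ = candidate y∈ z∈
    -- Here `x` and `y` choose each other, so a walk from `z` enters this pair and still visits all
    -- three corners.
    ... | inj₂ x∈ with cover (let a , b , c = t in adj-sym G c , a , adj-sym G b)
    ... | inj₁ x∈′ = subst (_∈ₗ candidates)
      (triangle-rotate (xz ∘ sym , xy , yz ∘ sym)) (candidate x∈′ y∈)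
    ... | inj₂ y∈′ = subst (_∈ₗ candidates)
      (trans (triangle-rotate (yz ∘ sym , xy ∘ sym , xz ∘ sym)) (triangle-swap (xy ∘ sym , xz , yz)))
      (candidate y∈′ x∈)

  copies⊆candidates : ∀ {T} → T ∈ₗ copies K₃ G → T ∈ₗ candidates
  copies⊆candidates T∈ with x , y , z , t@(a , b , c) , refl ← ∈-copies⁻ G T∈ with cover t
  ... | inj₁ y∈ = two-steps t y∈
  ... | inj₂ z∈ = subst (_∈ₗ candidates)
    (trans (triangle-swap (adj-irr G c , adj-irr G (adj-sym G b) , adj-irr G a))
      (triangle-rotate (adj-irr G (adj-sym G c) , adj-irr G a , adj-irr G (adj-sym G b))))
    (two-steps (c , adj-sym G b , a) z∈)

-- Bounds on `rex`

open Extrema ℕₚ.≤-totalOrder using (max≤v⁺; v≤max⁺)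

rex-≤ : ∀ {f h} (F : Graph f) (H : Graph h) n {b} →
  (∀ (G : Graph n) → Free F G → Regular G → 𝒩 H G ≤ b) → rex n H F ≤ b
rex-≤ F H n bound = max≤v⁺ z≤n (Allₚ.map⁺
  (All.map (λ {G} (free , regular) → bound G free regular)
    (Allₚ.all-filter (λ G → free? F G ×-dec regular? G) (graphs n))))

-- The enumeration carries the simplicity proof found by `isSimple?`, so a graph is matched only up
-- to that proof. Freeness, regularity and `𝒩` read the neighbourhoods alone.
∈-graphs : ∀ {n} (G : Graph n) → ∃ λ simple → mkGraph (neighbourhoods G) simple ∈ₗ graphs n
∈-graphs {n} (mkGraph N N-simple) = let _ , G∈ , N≡ = find found in listed G∈ N≡
  where
  decide : Neighbourhoods n → Data.Maybe.Maybe (Graph n)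
  decide N = Data.Maybe.map (mkGraph N) (dec⇒maybe (isSimple? N))
  Bool-∈ : ∀ b → b ∈ₗ true ∷ false ∷ []
  Bool-∈ true = here refl
  Bool-∈ false = there (here refl)
  decided : MAny.Any (λ G → neighbourhoods G ≡ N) (decide N)
  decided with isSimple? N
  ... | yes _ = MAny.just refl
  ... | no ¬simple = ⊥-elim (¬simple N-simple)
  found : Any (λ G → neighbourhoods G ≡ N) (graphs n)
  found = Anyₚ.mapMaybe⁺ decide (vectors (vectors (true ∷ false ∷ []) n) n)
    (Anyₚ.map⁺ (loseₗ (∈-vectors (∈-vectors Bool-∈) N) decided))
  listed : ∀ {G} → G ∈ₗ graphs n → neighbourhoods G ≡ N → ∃ λ simple → mkGraph N simple ∈ₗ graphs n
  listed {mkGraph _ simple} G∈ refl = simple , G∈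

≤-rex : ∀ {f h n} (F : Graph f) (H : Graph h) (G : Graph n) → Free F G → Regular G → 𝒩 H G ≤ rex n H F
≤-rex {n = n} F H G free regular with simple , G∈ ← ∈-graphs G =
  v≤max⁺ 0 (map (𝒩 H) (filter (λ G → free? F G ×-dec regular? G) (graphs n)))
    (inj₂ (loseₗ (∈-map⁺ (𝒩 H) (∈-filter⁺ (λ G → free? F G ×-dec regular? G) G∈
      (free , regular))) ℕₚ.≤-refl))

-- Regular graphs from neighbour functions

∈-tabulate⁺ : ∀ {n} {P : Fin n → Set} (P? : ∀ x → Dec (P x)) {x} → P x → x ∈ tabulate (does ∘ P?)
∈-tabulate⁺ P? {x} px = lookup⇒[]= x _ (trans (lookup∘tabulate (does ∘ P?) x) (dec-true (P? x) px))

∈-tabulate⁻ : ∀ {n} {P : Fin n → Set} (P? : ∀ x → Dec (P x)) {x} → x ∈ tabulate (does ∘ P?) → P x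
∈-tabulate⁻ P? {x} x∈ with P? x | trans (sym (lookup∘tabulate (does ∘ P?) x)) ([]=⇒lookup x∈)
... | yes px | _ = px

↔-injective : ∀ {A B : Set} (A↔B : A ↔ B) → Injective _≡_ _≡_ (Inverse.to A↔B)
↔-injective A↔B eq = trans (sym (strictlyInverseʳ _)) (trans (cong from eq) (strictlyInverseʳ _))
  where open Inverse A↔B

injective-into⇒≤length : ∀ {A B : Set} {N} {ys : List B} → Fin N ↔ A → (f : A → B) → Injective _≡_ _≡_ f →
  (∀ x → f x ∈ₗ ys) → N ≤ length ys
injective-into⇒≤length {B = B} enum f f-inj f∈ = injective⇒≤ λ {i} {j} eq →
  ↔-injective enum (f-inj
    (SetoidMembership.index-injective (setoid B) (f∈ (to i)) (f∈ (to j)) eq))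
  where open Inverse enum using (to)

-- A `D`-regular graph on structured vertices: each vertex has one neighbour per label, and
-- injectivity of `nb v` makes the degree exactly `D`. Enumerations transport it to `Fin n`.
record NeighbourSystem (n D : ℕ) : Set₁ where
  field
    Vertex Label : Set
    vertices     : Fin n ↔ Vertex
    labels       : Fin D ↔ Label
    nb           : Vertex → Label → Vertex
    nb-injective : ∀ v → Injective _≡_ _≡_ (nb v)
    nb-sym       : ∀ v l → ∃ λ l′ → nb (nb v l) l′ ≡ v
    nb-irr       : ∀ v l → nb v l ≢ v

  open Inverse vertices public using () renaming (to to ⟦_⟧; from to code)
  open Inverse labels using () renaming (to to label; from to unlabel)

  ⟦code⟧ : ∀ v → ⟦ code v ⟧ ≡ v
  ⟦code⟧ v = Inverse.strictlyInverseˡ vertices v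

  code⟦⟧ : ∀ x → code ⟦ x ⟧ ≡ x
  code⟦⟧ x = Inverse.strictlyInverseʳ vertices x

  nbs : Fin n → Fin D → Fin n
  nbs x i = code (nb ⟦ x ⟧ (label i))

  nbs? : ∀ x y → Dec (∃ λ i → nbs x i ≡ y)
  nbs? x y = any? (λ i → nbs x i ≟ y)

  abstract

    rows : Neighbourhoods n
    rows = tabulate (λ x → tabulate (does ∘ nbs? x))

    ∈-rows⁺ : ∀ {x y} → (∃ λ i → nbs x i ≡ y) → y ∈ lookup rows x
    ∈-rows⁺ {x} p = subst (_ ∈_) (sym (lookup∘tabulate (λ x → tabulate (does ∘ nbs? x)) x))
      (∈-tabulate⁺ (nbs? x) p)

    ∈-rows⁻ : ∀ {x y} → y ∈ lookup rows x → ∃ λ i → nbs x i ≡ y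
    ∈-rows⁻ {x} y∈ = ∈-tabulate⁻ (nbs? x)
      (subst (_ ∈_) (lookup∘tabulate (λ x → tabulate (does ∘ nbs? x)) x) y∈)

  nb⇒nbs : ∀ {x y l} → nb ⟦ x ⟧ l ≡ ⟦ y ⟧ → ∃ λ i → nbs x i ≡ y
  nb⇒nbs {x} {y} {l} eq = unlabel l , trans
    (cong code (trans (cong (nb ⟦ x ⟧) (Inverse.strictlyInverseˡ labels l)) eq)) (code⟦⟧ y)

  nbs⇒nb : ∀ {x y i} → nbs x i ≡ y → nb ⟦ x ⟧ (label i) ≡ ⟦ y ⟧
  nbs⇒nb {x} {i = i} eq = trans (sym (⟦code⟧ (nb ⟦ x ⟧ (label i)))) (cong ⟦_⟧ eq)

  graph : Graph n
  graph = mkGraph rows (symmetric , irreflexive)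
    where
    symmetric : ∀ x y → y ∈ lookup rows x → x ∈ lookup rows y
    symmetric x y y∈ = let
        i , eq = ∈-rows⁻ y∈
        l , eq′ = nb-sym ⟦ x ⟧ (label i)
      in ∈-rows⁺ (nb⇒nbs (trans (cong (λ v → nb v l) (sym (nbs⇒nb eq))) eq′))
    irreflexive : ∀ x → ¬ x ∈ lookup rows x
    irreflexive x x∈ = let i , eq = ∈-rows⁻ x∈ in nb-irr ⟦ x ⟧ (label i) (nbs⇒nb eq)

  adj⁺ : ∀ {u v l} → nb u l ≡ v → Adj graph (code u) (code v)
  adj⁺ {u} {v} {l} eq = ∈-rows⁺ (nb⇒nbs {l = l}
    (trans (cong (λ w → nb w l) (⟦code⟧ u)) (trans eq (sym (⟦code⟧ v)))))

  adj⁻ : ∀ {x y} → Adj graph x y → ∃ λ l → nb ⟦ x ⟧ l ≡ ⟦ y ⟧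
  adj⁻ y∈ = let i , eq = ∈-rows⁻ y∈ in label i , nbs⇒nb eq

  degree≡D : ∀ x → degree graph x ≡ D
  degree≡D x = ∣p∣≡size-of-enumeration (nbs x)
    (λ {i} {j} eq → ↔-injective labels (nb-injective ⟦ x ⟧
      (trans (sym (⟦code⟧ _)) (trans (cong ⟦_⟧ eq) (⟦code⟧ _)))))
    (λ i → ∈-rows⁺ (i , refl)) ∈-rows⁻

  regular : Regular graph
  regular x y = trans (degree≡D x) (sym (degree≡D y))

  code-injective : Injective _≡_ _≡_ code
  code-injective {u} {v} eq = trans (sym (⟦code⟧ u)) (trans (cong ⟦_⟧ eq) (⟦code⟧ v))

-- A regular graph with many triangles through one vertex

-- K_{2m,2m} minus a perfect matching between one half of each side, with a new
-- vertex joined to the two halves.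
module Apex (m : ℕ) where

  -- The entries of an inner vertex are its side, whether it lies in the half joined to the apex,
  -- and its index in that half.
  V = ⊤ ⊎ (Bool × Bool × Fin m)

  pattern apex = inj₁ tt
  pattern inner s h i = inj₂ (s , h , i)

  nb : V → Bool × Fin m → V
  nb apex (s , i) = inner s true i
  nb (inner s false i) (h , j) = inner (not s) h j
  nb (inner s true i) (false , j) = inner (not s) false j
  -- The label freed by the missing matching edge leads to the apex.
  nb (inner s true i) (true , j) with i ≟ j
  ... | yes _ = apex
  ... | no _ = inner (not s) true j

  nb-matched : ∀ s i → nb (inner s true i) (true , i) ≡ apex
  nb-matched s i with i ≟ i
  ... | yes _ = refl
  ... | no i≢i = ⊥-elim (i≢i refl)

  nb-unmatched : ∀ s {i j} → i ≢ j → nb (inner s true i) (true , j) ≡ inner (not s) true j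
  nb-unmatched s {i} {j} i≢j with i ≟ j
  ... | yes i≡j = ⊥-elim (i≢j i≡j)
  ... | no _ = refl

  -- Off the apex the graph is bipartite.
  nb-side : ∀ s h i l {s′ h′ i′} → nb (inner s h i) l ≡ inner s′ h′ i′ → s′ ≡ not s
  nb-side s false i (_ , _) refl = refl
  nb-side s true i (false , _) refl = refl
  nb-side s true i (true , j) eq with i ≟ j
  nb-side s true i (true , j) refl | no _ = refl

  nb-injective : ∀ v → Injective _≡_ _≡_ (nb v)
  nb-injective apex refl = refl
  nb-injective (inner s false i) refl = refl
  nb-injective (inner s true i) {false , j} {false , .j} refl = refl
  nb-injective (inner s true i) {false , j} {true , k} eq with i ≟ k
  nb-injective (inner s true i) {false , j} {true , k} () | yes _
  nb-injective (inner s true i) {false , j} {true , k} () | no _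
  nb-injective (inner s true i) {true , j} {false , k} eq with i ≟ j
  nb-injective (inner s true i) {true , j} {false , k} () | yes _
  nb-injective (inner s true i) {true , j} {false , k} () | no _
  nb-injective (inner s true i) {true , j} {true , k} eq with i ≟ j | i ≟ k
  nb-injective (inner s true i) {true , j} {true , k} eq | yes refl | yes refl = refl
  nb-injective (inner s true i) {true , j} {true , k} refl | no _ | no _ = refl

  nb-sym : ∀ v l → ∃ λ l′ → nb (nb v l) l′ ≡ v
  nb-sym apex (s , i) = (true , i) , nb-matched s i
  nb-sym (inner false false i) (false , j) = (false , i) , refl
  nb-sym (inner true false i) (false , j) = (false , i) , refl
  nb-sym (inner false false i) (true , j) = (false , i) , refl
  nb-sym (inner true false i) (true , j) = (false , i) , refl
  nb-sym (inner false true i) (false , j) = (true , i) , refl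
  nb-sym (inner true true i) (false , j) = (true , i) , refl
  nb-sym (inner s true i) (true , j) with i ≟ j
  nb-sym (inner s true i) (true , j) | yes _ = (s , i) , refl
  nb-sym (inner false true i) (true , j) | no i≢j = (true , i) , nb-unmatched true (i≢j ∘ sym)
  nb-sym (inner true true i) (true , j) | no i≢j = (true , i) , nb-unmatched false (i≢j ∘ sym)

  nb-irr : ∀ v l → nb v l ≢ v
  nb-irr (inner s h i) l eq = not-¬ {x = s} refl (nb-side s h i l eq)

  abstract

    vertices : Fin (1 + 2 * (2 * m)) ↔ V
    vertices = ↔-trans +↔⊎ (1↔⊤ ⊎-↔ ↔-trans *↔× (2↔Bool ×-↔ ↔-trans *↔× (2↔Bool ×-↔ ↔-refl)))

    labels : Fin (2 * m) ↔ (Bool × Fin m)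
    labels = ↔-trans *↔× (2↔Bool ×-↔ ↔-refl)

  system : NeighbourSystem (1 + 2 * (2 * m)) (2 * m)
  system = record
    { vertices = vertices ; labels = labels
    ; nb = nb ; nb-injective = nb-injective ; nb-sym = nb-sym ; nb-irr = nb-irr }

  open NeighbourSystem system hiding (nb; nb-injective; nb-sym; nb-irr; vertices; labels)

  centre : Fin (1 + 2 * (2 * m))
  centre = code apex

  -- A triangle avoiding the apex would have three corners pairwise on opposite sides.
  triangle-∋-centre : ∀ {x y z} → Triangle graph x y z → centre ≡ x ⊎ centre ≡ y ⊎ centre ≡ z
  triangle-∋-centre {x} {y} {z} (xy , yz , xz) with ⟦ x ⟧ in x-eq | ⟦ y ⟧ in y-eq | ⟦ z ⟧ in z-eq
  ... | apex | _ | _ = inj₁ (trans (cong code (sym x-eq)) (code⟦⟧ x))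
  ... | _ | apex | _ = inj₂ (inj₁ (trans (cong code (sym y-eq)) (code⟦⟧ y)))
  ... | _ | _ | apex = inj₂ (inj₂ (trans (cong code (sym z-eq)) (code⟦⟧ z)))
  ... | inner s h i | inner s′ h′ i′ | inner s″ h″ i″ =
    ⊥-elim (not-¬ {x = s″} refl (trans (side yz y-eq z-eq)
      (cong not (trans (side xy x-eq y-eq) (sym (side xz x-eq z-eq))))))
    where
    side : ∀ {u v s h i s′ h′ i′} → Adj graph u v → ⟦ u ⟧ ≡ inner s h i → ⟦ v ⟧ ≡ inner s′ h′ i′ → s′ ≡ not s
    side {s = s} {h} {i} uv u-eq v-eq = let l , eq = adj⁻ uv in
      nb-side s h i l (trans (cong (λ w → nb w l) (sym u-eq)) (trans eq v-eq))

module _ (p : ℕ) where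

  open Apex (suc p)
  open NeighbourSystem system hiding (nb; nb-injective; nb-sym; nb-irr; vertices; labels)

  -- The apex forms a triangle with any two vertices of different index in the joined halves of
  -- opposite sides; `punchIn i` runs through the indices other than `i`.
  spokes≤triangles : suc p * p ≤ 𝒩 K₃ graph
  spokes≤triangles = injective-into⇒≤length *↔× spoke spoke-injective λ (i , j) →
    ∈-copies⁺ graph
      ( adj⁺ {l = false , i} refl
      , adj⁺ {l = true , punchIn i j} (nb-unmatched false (punchInᵢ≢i i j ∘ sym))
      , adj⁺ {l = true , punchIn i j} refl)
    where
    spoke : Fin (suc p) × Fin p → Subgraph (1 + 2 * (2 * suc p))
    spoke (i , j) = triangle (code apex) (code (inner false true i)) (code (inner true true (punchIn i j)))
    spoke-injective : Injective _≡_ _≡_ spoke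
    spoke-injective {i , j} {i′ , j′} eq =
      conclude (near (∈-triangle eq (suc zero))) (far (∈-triangle eq (suc (suc zero))))
      where
      near : code (inner false true i) ≡ code apex ⊎ code (inner false true i) ≡ code (inner false true i′) ⊎
             code (inner false true i) ≡ code (inner true true (punchIn i′ j′)) → i ≡ i′
      near (inj₁ eq) with () ← code-injective {inner false true i} {apex} eq
      near (inj₂ (inj₁ eq)) with refl ← code-injective {inner false true i} {inner false true i′} eq = refl
      near (inj₂ (inj₂ eq)) with () ← code-injective {inner false true i} {inner true true _} eq
      far : ∀ {k k′} → code (inner true true k) ≡ code apex ⊎
            code (inner true true k) ≡ code (inner false true i′) ⊎
            code (inner true true k) ≡ code (inner true true k′) → k ≡ k′
      far {k} (inj₁ eq) with () ← code-injective {inner true true k} {apex} eq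
      far {k} (inj₂ (inj₁ eq)) with () ← code-injective {inner true true k} {inner false true i′} eq
      far {k} {k′} (inj₂ (inj₂ eq))
        with refl ← code-injective {inner true true k} {inner true true k′} eq = refl
      conclude : i ≡ i′ → punchIn i j ≡ punchIn i′ j′ → (i , j) ≡ (i′ , j′)
      conclude refl eq = cong (i ,_) (punchIn-injective i j j′ eq)

-- Bit vectors as vectors over Z₂

Bits↔ : ∀ m → Fin (2 ^ m) ↔ Vec Bool m
Bits↔ zero = mk↔ₛ′ (λ _ → []) (λ _ → zero) (λ { [] → refl }) (λ { zero → refl })
Bits↔ (suc m) = ↔-trans *↔× (↔-trans (2↔Bool ×-↔ Bits↔ m) ∷↔)
  where
  ∷↔ : (Bool × Vec Bool m) ↔ Vec Bool (suc m)
  ∷↔ = mk↔ₛ′ (uncurry _∷_) uncons (λ { (_ ∷ _) → refl }) (λ _ → refl)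

-- Addition of the unit vector at `c`.
flip : ∀ {m} → Fin m → Vec Bool m → Vec Bool m
flip c f = tabulate (λ x → lookup f x xor does (c ≟ x))

lookup-flip : ∀ {m} (c : Fin m) f x → lookup (flip c f) x ≡ lookup f x xor does (c ≟ x)
lookup-flip c f x = lookup∘tabulate (λ x → lookup f x xor does (c ≟ x)) x

lookup-ext : ∀ {m} {f g : Vec Bool m} → (∀ x → lookup f x ≡ lookup g x) → f ≡ g
lookup-ext {f = f} {g} f≗g = trans (sym (tabulate∘lookup f)) (trans (tabulate-cong f≗g) (tabulate∘lookup g))

-- Point sets with partitions into triples, of large girth

-- The orbits of `r i` form the `i`-th partition. A 3-colouring that changes with every rotation
-- forces all orbits to have three points, survives lifting, and later marks the corners of a
-- triangle.
record RotationSystem (d : ℕ) : Set₁ where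
  field
    Point    : Set
    size     : ℕ
    points   : Fin size ↔ Point
    base     : Point
    r        : Fin d → Point → Point
    r³       : ∀ i v → r i (r i (r i v)) ≡ v
    colour   : Point → Fin 3
    colour-r : ∀ i v → colour (r i v) ≢ colour v

  infix 4 _∼[_]_

  _∼[_]_ : Point → Fin d → Point → Set
  u ∼[ i ] v = u ≡ v ⊎ r i u ≡ v ⊎ r i (r i u) ≡ v

  ∼-sym : ∀ {i u v} → u ∼[ i ] v → v ∼[ i ] u
  ∼-sym (inj₁ refl) = inj₁ refl
  ∼-sym {i} {u} (inj₂ (inj₁ refl)) = inj₂ (inj₂ (r³ i u))
  ∼-sym {i} {u} (inj₂ (inj₂ refl)) = inj₂ (inj₁ (r³ i u))

  ∼-trans : ∀ {i u v w} → u ∼[ i ] v → v ∼[ i ] w → u ∼[ i ] w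
  ∼-trans (inj₁ refl) q = q
  ∼-trans (inj₂ (inj₁ refl)) (inj₁ refl) = inj₂ (inj₁ refl)
  ∼-trans (inj₂ (inj₁ refl)) (inj₂ (inj₁ refl)) = inj₂ (inj₂ refl)
  ∼-trans {i} {u} (inj₂ (inj₁ refl)) (inj₂ (inj₂ refl)) = inj₁ (sym (r³ i u))
  ∼-trans (inj₂ (inj₂ refl)) (inj₁ refl) = inj₂ (inj₂ refl)
  ∼-trans {i} {u} (inj₂ (inj₂ refl)) (inj₂ (inj₁ refl)) = inj₁ (sym (r³ i u))
  ∼-trans {i} {u} (inj₂ (inj₂ refl)) (inj₂ (inj₂ refl)) = inj₂ (inj₁ (cong (r i) (sym (r³ i u))))

  r-free : ∀ i v → r i v ≢ v
  r-free i v eq = colour-r i v (cong colour eq)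

  r²-free : ∀ i v → r i (r i v) ≢ v
  r²-free i v eq = colour-r i (r i (r i v)) (cong colour (trans (r³ i v) (sym eq)))

  colour-proper : ∀ {i u v} → u ∼[ i ] v → u ≢ v → colour u ≢ colour v
  colour-proper (inj₁ refl) u≢v _ = u≢v refl
  colour-proper {i} {u} (inj₂ (inj₁ refl)) _ eq = colour-r i u (sym eq)
  colour-proper {i} {u} (inj₂ (inj₂ refl)) _ eq = colour-r i (r i (r i u))
    (trans (cong colour (r³ i u)) eq)

  _≟ₚ_ : DecidableEquality Point
  u ≟ₚ v = map′ (↔-injective (↔-sym points)) (cong (Inverse.from points))
    (Inverse.from points u ≟ Inverse.from points v)

  -- A walk without backtracking in the incidence graph of points and orbits: every step moves, and
  -- consecutive steps use different partitions. The index is the partition of the first step.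
  data Walk : Fin d → Point → Point → Set

  first : ∀ {i u v} → Walk i u v → Point

  data Walk where
    step : ∀ {i u v} → u ∼[ i ] v → u ≢ v → Walk i u v
    cons : ∀ {i j u v w} → u ∼[ i ] v → u ≢ v → i ≢ j → Walk j v w → Walk i u w

  first {v = v} (step _ _) = v
  first (cons {v = v} _ _ _ _) = v

  len : ∀ {i u v} → Walk i u v → ℕ
  len (step _ _) = 1
  len (cons _ _ _ w) = suc (len w)

  -- The closing step may be trivial and is compared only with the first step of the walk, so it may
  -- share its partition with the last one.
  HasGirth : ℕ → Set
  HasGirth g = ∀ {i j u v} (w : Walk j u v) → i ≢ j → len w ≤ g → ¬ (u ∼[ i ] v)

  -- A step inside the first orbit of the walk is absorbed by moving the starting point within that
  -- orbit.
  merge : ∀ {i x u v} → x ∼[ i ] u → (w : Walk i u v) → x ≢ first w →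
          Σ (Walk i x v) λ w′ → len w′ ≤ len w × first w′ ≡ first w
  merge x∼u (step s _) x≢ = step (∼-trans x∼u s) x≢ , ℕₚ.≤-refl , refl
  merge x∼u (cons s _ i≢j w) x≢ = cons (∼-trans x∼u s) x≢ i≢j w , ℕₚ.≤-refl , refl

  Steps : ∀ {m} → (Fin (suc m) → Point) → Set
  Steps {m} c = ∀ (t : Fin m) → ∃ λ i → c (inject₁ t) ∼[ i ] c (suc t)

  -- Consecutive edges in one orbit are merged into one step. Knowing that the first step ends on
  -- the path lets injectivity supply the inequality needed by the next `merge`.
  path⇒walk : ∀ {m} (c : Fin (suc (suc m)) → Point) → Injective _≡_ _≡_ c → Steps c →
    ∃ λ i → Σ (Walk i (c zero) (c (fromℕ (suc m)))) λ w → len w ≤ suc m × ∃ λ t → first w ≡ c (suc t)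
  path⇒walk {zero} c c-inj steps =
    let i , s = steps zero in i , step s (λ eq → 0≢1+n (c-inj eq)) , s≤s z≤n , zero , refl
  path⇒walk {suc m} c c-inj steps
    with i , s ← steps zero
    with j , w , w≤ , t , first≡ ← path⇒walk (c ∘ suc) (suc-injective ∘ c-inj) (steps ∘ suc)
    with i ≟ j
  ... | no i≢j = i , cons s (λ eq → 0≢1+n (c-inj eq)) i≢j w , s≤s w≤ , zero , refl
  ... | yes refl =
    let w′ , w′≤ , first′ = merge s w (λ eq → 0≢1+n (c-inj (trans eq first≡))) in
    i , w′ , ℕₚ.≤-trans w′≤ (ℕₚ.m≤n⇒m≤1+n w≤) , suc t , trans first′ first≡

  -- If `i` and `j` differed, the path preceded by the step from `u` in orbit `i` would be a short
  -- walk closed by orbit `j`.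
  detour⇒same-orbit : ∀ {g} → HasGirth g → ∀ {m u i j} (c : Fin (suc (suc m)) → Point) →
    Injective _≡_ _≡_ c → Steps c → (∀ t → u ≢ c t) →
    u ∼[ i ] c zero → u ∼[ j ] c (fromℕ (suc m)) → suc (suc m) ≤ g → i ≡ j
  detour⇒same-orbit girth {u = u} {i} {j} c c-inj steps avoids ui uj m≤g
    with i ≟ j | path⇒walk c c-inj steps
  ... | yes i≡j | _ = i≡j
  ... | no i≢j | k , w , w≤ , t , first≡ with i ≟ k
  ... | no i≢k = ⊥-elim (girth (cons ui (avoids zero) i≢k w) (i≢j ∘ sym)
    (ℕₚ.≤-trans (s≤s w≤) m≤g) uj)
  ... | yes refl = let w′ , w′≤ , _ = merge ui w (λ eq → avoids (suc t) (trans eq first≡)) in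
    ⊥-elim (girth w′ (i≢j ∘ sym) (ℕₚ.≤-trans (ℕₚ.≤-trans w′≤ (ℕₚ.m≤n⇒m≤1+n w≤)) m≤g) uj)

  orbit-size : ∀ {i v a b c} → v ∼[ i ] a → v ∼[ i ] b → v ∼[ i ] c →
    v ≢ a → v ≢ b → v ≢ c → a ≢ b → a ≢ c → b ≢ c → ⊥
  orbit-size (inj₁ va) _ _ v≢a _ _ _ _ _ = v≢a va
  orbit-size _ (inj₁ vb) _ _ v≢b _ _ _ _ = v≢b vb
  orbit-size _ _ (inj₁ vc) _ _ v≢c _ _ _ = v≢c vc
  orbit-size (inj₂ (inj₁ refl)) (inj₂ (inj₁ refl)) _ _ _ _ a≢b _ _ = a≢b refl
  orbit-size (inj₂ (inj₂ refl)) (inj₂ (inj₂ refl)) _ _ _ _ a≢b _ _ = a≢b refl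
  orbit-size (inj₂ (inj₁ refl)) _ (inj₂ (inj₁ refl)) _ _ _ _ a≢c _ = a≢c refl
  orbit-size (inj₂ (inj₂ refl)) _ (inj₂ (inj₂ refl)) _ _ _ _ a≢c _ = a≢c refl
  orbit-size _ (inj₂ (inj₁ refl)) (inj₂ (inj₁ refl)) _ _ _ _ _ b≢c = b≢c refl
  orbit-size _ (inj₂ (inj₂ refl)) (inj₂ (inj₂ refl)) _ _ _ _ _ b≢c = b≢c refl

-- Iterated lifts and large girth

base-system : ∀ d → RotationSystem d
base-system d = record
  { Point = Fin 3 ; size = 3 ; points = ↔-refl ; base = zero ; r = λ _ → rotate
  ; r³ = λ _ → rotate³ ; colour = id ; colour-r = λ _ → rotate-free }
  where
  rotate : Fin 3 → Fin 3
  rotate zero = suc zero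
  rotate (suc zero) = suc (suc zero)
  rotate (suc (suc zero)) = zero
  rotate³ : ∀ v → rotate (rotate (rotate v)) ≡ v
  rotate³ zero = refl
  rotate³ (suc zero) = refl
  rotate³ (suc (suc zero)) = refl
  rotate-free : ∀ v → rotate v ≢ v
  rotate-free zero ()
  rotate-free (suc zero) ()
  rotate-free (suc (suc zero)) ()

-- Vacuous, since every walk has at least one step.
base-girth : ∀ d → RotationSystem.HasGirth (base-system d) 0
base-girth d (RotationSystem.step _ _) _ ()
base-girth d (RotationSystem.cons _ _ _ _) _ ()

-- The Z₂-lift with one coordinate for each incidence of a point with an orbit:
-- a step along an orbit flips the coordinates of its two ends.
module Lift {d : ℕ} (S : RotationSystem d) where

  open RotationSystem S

  coord : Fin d → Point → Fin (d * size)
  coord i v = combine i (Inverse.from points v)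

  coord-injective : ∀ {i j u v} → coord i u ≡ coord j v → i ≡ j × u ≡ v
  coord-injective {i} {j} {u} {v} eq =
    let i≡j , u≡v = combine-injective i (Inverse.from points u) j (Inverse.from points v) eq in
    i≡j , ↔-injective (↔-sym points) u≡v

  Point′ = Point × Vec Bool (d * size)

  r′ : Fin d → Point′ → Point′
  r′ i (v , f) = r i v , flip (coord i (r i v)) (flip (coord i v) f)

  lookup-r′ : ∀ i v f c → lookup (proj₂ (r′ i (v , f))) c ≡
    (lookup f c xor does (coord i v ≟ c)) xor does (coord i (r i v) ≟ c)
  lookup-r′ i v f c = trans (lookup-flip (coord i (r i v)) (flip (coord i v) f) c)
    (cong (_xor _) (lookup-flip (coord i v) f c))

  -- The middle coordinate is flipped twice, so two rotations also flip just the coordinates of the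
  -- two ends.
  lookup-r′² : ∀ i v f c → lookup (proj₂ (r′ i (r′ i (v , f)))) c ≡
    (lookup f c xor does (coord i v ≟ c)) xor does (coord i (r i (r i v)) ≟ c)
  lookup-r′² i v f c = trans (lookup-r′ i (r i v) (proj₂ (r′ i (v , f))) c)
    (trans (cong (λ b → (b xor _) xor _) (lookup-r′ i v f c))
      (cancel (lookup f c xor does (coord i v ≟ c)) (does (coord i (r i v) ≟ c)) _))
    where
    cancel : ∀ x y z → ((x xor y) xor y) xor z ≡ x xor z
    cancel true true z = refl
    cancel true false z = refl
    cancel false true z = refl
    cancel false false z = refl

  lifted : RotationSystem d
  lifted = record
    { Point = Point′ ; size = size * 2 ^ (d * size)
    ; points = ↔-trans *↔× (points ×-↔ Bits↔ (d * size))
    ; base = base , tabulate (λ _ → false)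
    ; r = r′
    ; r³ = λ i (v , f) → cong₂ _,_ (r³ i v) (lookup-ext λ c →
        trans (lookup-r′² i (r i v) (proj₂ (r′ i (v , f))) c)
          (trans (cong₂ (λ b u → (b xor does (coord i (r i v) ≟ c)) xor does (coord i u ≟ c))
            (lookup-r′ i v f c) (r³ i v))
            (cancel (lookup f c) (does (coord i v ≟ c)) (does (coord i (r i v) ≟ c)))))
    ; colour = λ (v , _) → colour v
    ; colour-r = λ i (v , _) → colour-r i v }
    where
    cancel : ∀ x y z → (((x xor y) xor z) xor z) xor y ≡ x
    cancel true true true = refl
    cancel true true false = refl
    cancel true false true = refl
    cancel true false false = refl
    cancel false true true = refl
    cancel false true false = refl
    cancel false false true = refl
    cancel false false false = refl

  module L = RotationSystem lifted

  project : ∀ {i p q} → p L.∼[ i ] q → proj₁ p ∼[ i ] proj₁ q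
  project (inj₁ refl) = inj₁ refl
  project (inj₂ (inj₁ refl)) = inj₂ (inj₁ refl)
  project (inj₂ (inj₂ refl)) = inj₂ (inj₂ refl)

  project-≢ : ∀ {i p q} → p L.∼[ i ] q → p ≢ q → proj₁ p ≢ proj₁ q
  project-≢ (inj₁ refl) p≢q _ = p≢q refl
  project-≢ {i} {v , _} (inj₂ (inj₁ refl)) _ eq = r-free i v (sym eq)
  project-≢ {i} {v , _} (inj₂ (inj₂ refl)) _ eq = r²-free i v (sym eq)

  lookup-step : ∀ {i u f v h} → (u , f) L.∼[ i ] (v , h) → ∀ c →
    lookup h c ≡ (lookup f c xor does (coord i u ≟ c)) xor does (coord i v ≟ c)
  lookup-step {i} {u} {f} (inj₁ refl) c = cancel (lookup f c) (does (coord i u ≟ c))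
    where
    cancel : ∀ x y → x ≡ (x xor y) xor y
    cancel true true = refl
    cancel true false = refl
    cancel false true = refl
    cancel false false = refl
  lookup-step {i} {u} {f} (inj₂ (inj₁ refl)) c = lookup-r′ i u f c
  lookup-step {i} {u} {f} (inj₂ (inj₂ refl)) c = lookup-r′² i u f c

  unflipped : ∀ {i u f v h} → (u , f) L.∼[ i ] (v , h) → ∀ c →
    coord i u ≢ c → coord i v ≢ c → lookup f c ≡ lookup h c
  unflipped {i} {u} {f} {v} s c u≢ v≢ = sym (trans (lookup-step s c)
    (trans (cong₂ (λ a b → (lookup f c xor a) xor b)
      (dec-false (coord i u ≟ c) u≢) (dec-false (coord i v ≟ c) v≢)) (xor-false (lookup f c))))
    where
    xor-false : ∀ x → (x xor false) xor false ≡ x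
    xor-false true = refl
    xor-false false = refl

  flipped : ∀ {i u f v h} → (u , f) L.∼[ i ] (v , h) → u ≢ v →
            lookup f (coord i u) ≢ lookup h (coord i u)
  flipped {i} {u} {f} {v} s u≢v eq = not-fixed (lookup f (coord i u))
    (trans eq (trans (lookup-step s (coord i u))
      (cong₂ (λ a b → (lookup f (coord i u) xor a) xor b)
        (dec-true (coord i u ≟ coord i u) refl)
        (dec-false (coord i v ≟ coord i u) λ eq → u≢v (sym (proj₂ (coord-injective eq)))))))
    where
    not-fixed : ∀ x → x ≢ (x xor true) xor false
    not-fixed true ()
    not-fixed false ()

  Prefix : Fin d → Point → Point → ℕ → Set
  Prefix k x z n = Σ (Walk k x z) λ w → len w < n

  -- A coordinate can change only in a step of partition `j` with `u` as an end. The part of the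
  -- walk before that step, projected to `S`, leads to a point in the orbit of `u`; if it is the
  -- first step, that point is the start.
  unchanged-or-visits : ∀ {k x f y h} (w : L.Walk k (x , f) (y , h)) j u →
    lookup f (coord j u) ≡ lookup h (coord j u) ⊎
    (k ≡ j × x ∼[ j ] u) ⊎
    ∃ λ z → Prefix k x z (L.len w) × z ∼[ j ] u
  unchanged-or-visits {k} {x} {f} {y} {h} (L.step s p≢q) j u
    with coord k x ≟ coord j u | coord k y ≟ coord j u
  ... | yes eq | _ = let k≡j , x≡u = coord-injective eq in inj₂ (inj₁ (k≡j , inj₁ x≡u))
  ... | no _ | yes eq with refl , refl ← coord-injective eq = inj₂ (inj₁ (refl , project s))
  ... | no x≢ | no y≢ = inj₁ (unflipped s _ x≢ y≢)
  unchanged-or-visits {k} {x} {f} {y} {h} (L.cons {v = z , e} s p≢q k≢k′ w) j u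
    with coord k x ≟ coord j u | coord k z ≟ coord j u
  ... | yes eq | _ = let k≡j , x≡u = coord-injective eq in inj₂ (inj₁ (k≡j , inj₁ x≡u))
  ... | no _ | yes eq with refl , refl ← coord-injective eq = inj₂ (inj₁ (refl , project s))
  ... | no x≢ | no z≢ with unchanged-or-visits w j u
  ... | inj₁ eq = inj₁ (trans (unflipped s _ x≢ z≢) eq)
  ... | inj₂ (inj₁ (refl , z∼u)) =
    inj₂ (inj₂ (z , (step (project s) (project-≢ s p≢q) , s≤s (walk-nonempty w)) , z∼u))
    where
    walk-nonempty : ∀ {k p q} (w : L.Walk k p q) → 1 ≤ L.len w
    walk-nonempty (L.step _ _) = s≤s z≤n
    walk-nonempty (L.cons _ _ _ _) = s≤s z≤n
  ... | inj₂ (inj₂ (t , (w′ , w′<) , t∼u)) =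
    inj₂ (inj₂ (t , (cons (project s) (project-≢ s p≢q) k≢k′ w′ , s≤s w′<) , t∼u))

  -- The first step flips `coord j u` and the closing step, in partition `i`, leaves it alone, so
  -- the rest of the walk has to flip it back. Then a proper prefix of the rest reaches the orbit of
  -- `u` in partition `j`; in `S` that orbit closes this prefix, against the girth of `S`.
  lifted-girth : ∀ {g} → HasGirth g → L.HasGirth (suc g)
  lifted-girth girth {i} {j} {u , f} {v , h} (L.step s p≢q) i≢j _ closed =
    flipped s (project-≢ s p≢q) (unflipped closed (coord j u)
      (i≢j ∘ proj₁ ∘ coord-injective) (i≢j ∘ proj₁ ∘ coord-injective))
  lifted-girth girth {i} {j} {u , f} {v , h} (L.cons {v = m , e} s p≢q j≢k w) i≢j (s≤s w≤g) closed
    with unchanged-or-visits w j u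
  ... | inj₁ eq = flipped s (project-≢ s p≢q) (trans (unflipped closed (coord j u)
      (i≢j ∘ proj₁ ∘ coord-injective) (i≢j ∘ proj₁ ∘ coord-injective)) (sym eq))
  ... | inj₂ (inj₁ (k≡j , _)) = j≢k (sym k≡j)
  ... | inj₂ (inj₂ (z , (w′ , w′<) , z∼u)) =
    girth w′ j≢k (ℕₚ.≤-trans (ℕₚ.<⇒≤ w′<) w≤g) (∼-sym (∼-trans z∼u (project s)))

high-girth : ∀ d g → Σ (RotationSystem d) λ S → RotationSystem.HasGirth S g
high-girth d zero = base-system d , base-girth d
high-girth d (suc g) = let S , girth = high-girth d g in
  Lift.lifted S , λ {i} → Lift.lifted-girth S girth {i}

-- The orbit graph: short cycles and number of triangles

module OrbitGraph {d : ℕ} (S : RotationSystem d) {g : ℕ} (girth : RotationSystem.HasGirth S (suc g)) where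

  open RotationSystem S

  -- Two points in two orbits would be a closed walk of one step, which girth at least 1 forbids.
  orbits-meet-once : ∀ {i j u v} → u ∼[ i ] v → u ∼[ j ] v → u ≢ v → i ≡ j
  orbits-meet-once {i} {j} ui uj u≢v with i ≟ j
  ... | yes i≡j = i≡j
  ... | no i≢j = ⊥-elim (girth (step uj u≢v) i≢j (s≤s z≤n) ui)

  nb : Point → Fin d × Bool → Point
  nb v (i , false) = r i v
  nb v (i , true) = r i (r i v)

  nb-∼ : ∀ v i b → v ∼[ i ] nb v (i , b)
  nb-∼ v i false = inj₂ (inj₁ refl)
  nb-∼ v i true = inj₂ (inj₂ refl)

  nb-irr : ∀ v l → nb v l ≢ v
  nb-irr v (i , false) = r-free i v
  nb-irr v (i , true) = r²-free i v

  nb-injective : ∀ v → Injective _≡_ _≡_ (nb v)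
  nb-injective v {i , b} {j , c} eq
    with refl ← orbits-meet-once (nb-∼ v i b) (subst (v ∼[ j ]_) (sym eq) (nb-∼ v j c)) (nb-irr v (i , b) ∘ sym)
    = cong (i ,_) (same b c eq)
    where
    same : ∀ b c → nb v (i , b) ≡ nb v (i , c) → b ≡ c
    same false false _ = refl
    same false true eq = ⊥-elim (r-free i (r i v) (sym eq))
    same true false eq = ⊥-elim (r-free i (r i v) eq)
    same true true _ = refl

  nb-sym : ∀ v l → ∃ λ l′ → nb (nb v l) l′ ≡ v
  nb-sym v (i , false) = (i , true) , r³ i v
  nb-sym v (i , true) = (i , false) , r³ i v

  abstract
    labels : Fin (d * 2) ↔ (Fin d × Bool)
    labels = ↔-trans *↔× (↔-refl ×-↔ 2↔Bool)

  system : NeighbourSystem size (d * 2)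
  system = record
    { vertices = points ; labels = labels
    ; nb = nb ; nb-injective = nb-injective ; nb-sym = nb-sym ; nb-irr = nb-irr }

  open NeighbourSystem system public using (graph; code; ⟦_⟧; regular; code-injective; adj⁺; adj⁻; degree≡D)

  -- The degree `d * 2` is at most the number of vertices. Hence a large `d` also makes the graph
  -- large.
  d≤size : d ≤ size
  d≤size = ℕₚ.≤-trans (ℕₚ.m≤m*n d 2)
    (subst (_≤ size) (degree≡D (code base)) (∣p∣≤n (neighbours graph (code base))))

  adj⇒∼ : ∀ {x y} → Adj graph x y → ∃ λ i → ⟦ x ⟧ ∼[ i ] ⟦ y ⟧
  adj⇒∼ {x} xy = let (i , b) , eq = adj⁻ xy in i , subst (⟦ x ⟧ ∼[ i ]_) eq (nb-∼ ⟦ x ⟧ i b)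

  ⟦⟧-injective : Injective _≡_ _≡_ ⟦_⟧
  ⟦⟧-injective = ↔-injective points

  -- In a longer cycle, `detour⇒same-orbit` would force four vertices into one orbit.
  short-cycles : ∀ {m} (c : Fin (suc m) → Fin size) → IsCycle graph c → m ≤ g → suc m ≡ 3
  short-cycles {suc (suc zero)} c _ _ = refl
  short-cycles {zero} c cycle _ with s≤s () ← IsCycle.length≥3 cycle
  short-cycles {suc zero} c cycle _ with s≤s (s≤s ()) ← IsCycle.length≥3 cycle
  short-cycles {suc (suc (suc m))} c cycle m≤g = ⊥-elim impossible
    where
    open IsCycle cycle renaming (step to edge)
    p : Fin (4 + m) → Point
    p = ⟦_⟧ ∘ c
    p-inj : Injective _≡_ _≡_ p
    p-inj = injective ∘ ⟦⟧-injective
    steps : Steps p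
    steps t = adj⇒∼ (edge t)
    last = fromℕ (3 + m)
    impossible : ⊥
    impossible with i , p₀₁ ← steps zero | j , pₗ₀ ← adj⇒∼ close | k , p₁₂ ← steps (suc zero)
      -- The path left after deleting vertex 0 puts both edges at vertex 0 in one orbit.
      with refl ← detour⇒same-orbit girth (p ∘ suc) (suc-injective ∘ p-inj) (steps ∘ suc)
             (λ _ eq → 0≢1+n (p-inj eq)) p₀₁ (∼-sym pₗ₀) (ℕₚ.m≤n⇒m≤1+n m≤g)
      -- Vertex 1 thus shares orbit `i` with the last vertex; the path from vertex 2 to the last one
      -- puts vertex 2 there too.
      with refl ← detour⇒same-orbit girth (λ t → p (suc (suc t))) (suc-injective ∘ suc-injective ∘ p-inj)
             (λ t → steps (suc (suc t))) (λ _ eq → 0≢1+n (suc-injective (p-inj eq))) p₁₂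
             (∼-trans (∼-sym p₀₁) (∼-sym pₗ₀)) (ℕₚ.m≤n⇒m≤1+n (ℕₚ.<⇒≤ m≤g))
      = orbit-size (∼-sym p₀₁) p₁₂ (∼-trans (∼-sym p₀₁) (∼-sym pₗ₀))
          (λ eq → 0≢1+n (sym (p-inj eq)))
          (λ eq → 0≢1+n (suc-injective (p-inj eq)))
          (λ eq → 0≢1+n (suc-injective (p-inj eq)))
          (λ eq → 0≢1+n (p-inj eq))
          (λ eq → 0≢1+n (p-inj eq))
          (λ eq → 0≢1+n (suc-injective (suc-injective (p-inj eq))))

  -- The colour of a corner singles it out, so each triangle arises at most three times.
  many-triangles : size * d ≤ 𝒩 K₃ graph * 3
  many-triangles = ℕₚ.≤-trans
    (injective-into⇒≤length {ys = cartesianProduct (copies K₃ graph) (allFin 3)}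
      (↔-trans *↔× (points ×-↔ ↔-refl)) orbit orbit-injective
      (λ (v , i) → ∈-cartesianProduct⁺ (∈-copies⁺ graph
        ( adj⁺ {l = i , false} refl , adj⁺ {l = i , false} refl , adj⁺ {l = i , true} refl))
        (∈-allFin (colour v))))
    (ℕₚ.≤-reflexive (length-cartesianProduct (copies K₃ graph) (allFin 3)))
    where
    length-cartesianProduct : ∀ {A B : Set} (xs : List A) (ys : List B) →
      length (cartesianProduct xs ys) ≡ length xs * length ys
    length-cartesianProduct [] ys = refl
    length-cartesianProduct (x ∷ xs) ys = trans (length-++ (Data.List.map (x ,_) ys))
      (cong₂ _+_ (length-map (x ,_) ys) (length-cartesianProduct xs ys))

    orbit : Point × Fin d → Subgraph size × Fin 3
    orbit (v , i) = triangle (code v) (code (r i v)) (code (r i (r i v))) , colour v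

    in-orbit : ∀ {u v i} → code u ≡ code v ⊎ code u ≡ code (r i v) ⊎ code u ≡ code (r i (r i v)) → v ∼[ i ] u
    in-orbit (inj₁ eq) = inj₁ (sym (code-injective eq))
    in-orbit (inj₂ (inj₁ eq)) = inj₂ (inj₁ (sym (code-injective eq)))
    in-orbit (inj₂ (inj₂ eq)) = inj₂ (inj₂ (sym (code-injective eq)))

    orbit-injective : Injective _≡_ _≡_ orbit
    orbit-injective {v , i} {u , j} eq = conclude (v ≟ₚ u)
      where
      same : triangle (code v) (code (r i v)) (code (r i (r i v))) ≡
             triangle (code u) (code (r j u)) (code (r j (r j u)))
      same = cong proj₁ eq
      conclude : Dec (v ≡ u) → (v , i) ≡ (u , j)
      conclude (no v≢u) = ⊥-elim (colour-proper
        (in-orbit {v} {u} {j} (∈-triangle same zero)) (v≢u ∘ sym) (sym (cong proj₂ eq)))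
      conclude (yes refl) = cong (v ,_) (orbits-meet-once (inj₂ (inj₁ refl))
        (in-orbit {r i v} {v} {j} (∈-triangle same (suc zero))) (r-free i v ∘ sym))

-- Pigeonhole and differences of finite sets

_∈ₗ?_ : ∀ {n} (x : Fin n) (xs : List (Fin n)) → Dec (x ∈ₗ xs)
x ∈ₗ? xs = Any.any? (x ≟_) xs

larger⇒escapes : ∀ {n} (p : Subset n) (xs : List (Fin n)) → length xs < ∣ p ∣ → ∃ λ x → x ∈ p × x ∉ₗ xs
larger⇒escapes p xs xs<p with any? (λ x → x ∈? p ×-dec ¬? (x ∈ₗ? xs))
... | yes found = found
... | no none = ⊥-elim (ℕₚ.<⇒≱ xs<p (subst (_≤ length xs) (length-elements p)
  (unique⊆⇒length≤ (elements-unique p) λ {x} x∈ →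
    decidable-stable (x ∈ₗ? xs) λ x∉ → none (x , ∈-elements⁻ x∈ , x∉))))

≢⇒difference : ∀ {n} {p q : Subset n} → p ≢ q → ∃ λ x → (x ∈ p × x ∉ q) ⊎ (x ∈ q × x ∉ p)
≢⇒difference {p = p} {q} p≢q
  with any? (λ x → x ∈? p ×-dec ¬? (x ∈? q)) | any? (λ x → x ∈? q ×-dec ¬? (x ∈? p))
... | yes (x , d) | _ = x , inj₁ d
... | _ | yes (x , d) = x , inj₂ d
... | no p⊆q | no q⊆p = ⊥-elim (p≢q (⊆-antisym
  (λ {x} x∈p → decidable-stable (x ∈? q) λ x∉q → p⊆q (x , x∈p , x∉q))
  (λ {x} x∈q → decidable-stable (x ∈? p) λ x∉p → q⊆p (x , x∈q , x∉p))))

◃-injective : ∀ {A : Set} {m} {x : A} {c : Fin m → A} → (∀ i → x ≢ c i) → Injective _≡_ _≡_ c →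
              Injective _≡_ _≡_ (x ◃ c)
◃-injective x∉c c-inj {zero} {zero} _ = refl
◃-injective x∉c c-inj {zero} {suc j} eq = ⊥-elim (x∉c j eq)
◃-injective x∉c c-inj {suc i} {zero} eq = ⊥-elim (x∉c i (sym eq))
◃-injective x∉c c-inj {suc i} {suc j} eq = cong suc (c-inj eq)

-- Extended friendship graphs from excluded subgraphs

module Triangles {k} (F : Graph k) where

  third-vertex : ∀ {T} → IsTriangle F T → ∀ x y → ∃ λ z → z ∈ T × z ≢ x × z ≢ y
  third-vertex {T} (∣T∣≡3 , _) x y =
    let z , z∈ , z∉ = larger⇒escapes T (x ∷ y ∷ []) (ℕₚ.≤-reflexive (sym ∣T∣≡3))
    in z , z∈ , (λ z≡x → z∉ (here z≡x)) , (λ z≡y → z∉ (there (here z≡y)))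

  triangle-corners : ∀ {T} → IsTriangle F T →
    ∃ λ x → ∃ λ y → ∃ λ z → (x ∈ T × y ∈ T × z ∈ T) × Triangle F x y z
  triangle-corners {T} t@(∣T∣≡3 , adj) =
    let x , x∈ , _ = larger⇒escapes T [] (subst (0 <_) (sym ∣T∣≡3) (s≤s z≤n))
        y , y∈ , y≢x , _ = third-vertex t x x
        z , z∈ , z≢x , z≢y = third-vertex t x y
    in x , y , z , (x∈ , y∈ , z∈)
       , adj x y x∈ y∈ (y≢x ∘ sym) , adj y z y∈ z∈ (z≢y ∘ sym) , adj x z x∈ z∈ (z≢x ∘ sym)

  isTriangle? : ∀ T → Dec (IsTriangle F T)
  isTriangle? T = (∣ T ∣ ℕ.≟ 3) ×-dec all? (λ i → all? (λ j →
    (i ∈? T) →-dec ((j ∈? T) →-dec (¬? (i ≟ j) →-dec adj? F i j))))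

  TriangleCycles PairwiseMeeting : Set
  TriangleCycles = ∀ {m} (c : Fin (suc m) → Fin k) → IsCycle F c → suc m ≡ 3
  PairwiseMeeting = ∀ T T′ → IsTriangle F T → IsTriangle F T′ → ∃ λ x → x ∈ T × x ∈ T′

  no-4-cycle : TriangleCycles → ∀ {a b c d} → Adj F a b → Adj F b c → Adj F c d → Adj F d a →
               a ≢ c → b ≢ d → ⊥
  no-4-cycle only3 {a} {b} {c} {d} ab bc cd da a≢c b≢d = 4≢3 (only3 cycle record
    { length≥3 = s≤s (s≤s (s≤s z≤n))
    ; injective =
        ◃-injective {c = b ◃ c ◃ (λ _ → d)}
          (λ { zero → adj-irr F ab ; (suc zero) → a≢c ; (suc (suc zero)) → adj-irr F da ∘ sym })
        (◃-injective {c = c ◃ (λ _ → d)} (λ { zero → adj-irr F bc ; (suc zero) → b≢d })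
        (◃-injective {c = λ _ → d} (λ { zero → adj-irr F cd }) (λ { {zero} {zero} _ → refl })))
    ; step = λ { zero → ab ; (suc zero) → bc ; (suc (suc zero)) → cd }
    ; close = da })
    where
    4≢3 : 4 ≢ 3
    4≢3 ()
    cycle : Fin 4 → Fin k
    cycle = a ◃ b ◃ c ◃ (λ _ → d)

  module _ (only3 : TriangleCycles) where

    -- With `h` the third corner of `T′`, the vertices `a`, `p`, `h`, `e` form a 4-cycle.
    share-two : ∀ {T T′} → IsTriangle F T → IsTriangle F T′ → ∀ {p e a} → p ≢ e →
      p ∈ T → p ∈ T′ → e ∈ T → e ∈ T′ → a ∈ T → a ∉ T′ → ⊥
    share-two (_ , adj) t′@(_ , adj′) {p} {e} {a} p≢e p∈ p∈′ e∈ e∈′ a∈ a∉′ =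
      let h , h∈′ , h≢p , h≢e = third-vertex t′ p e in
      no-4-cycle only3
        (adj a p a∈ p∈ λ { refl → a∉′ p∈′ }) (adj′ p h p∈′ h∈′ (h≢p ∘ sym))
        (adj′ h e h∈′ e∈′ h≢e) (adj e a e∈ a∈ λ { refl → a∉′ e∈′ })
        (λ { refl → a∉′ h∈′ }) p≢e

    Centre : Fin k → Set
    Centre v = ∀ T T′ → IsTriangle F T → IsTriangle F T′ → T ≢ T′ → T ∩ T′ ≡ ⁅ v ⁆

    in-all⇒centre : ∀ {v} → (∀ T → IsTriangle F T → v ∈ T) → Centre v
    in-all⇒centre {v} v∈ T T′ t t′ T≢T′ = ⊆-antisym only-v
      (λ x∈ → subst (_∈ T ∩ T′) (sym (x∈⁅y⁆⇒x≡y v x∈)) (x∈p∩q⁺ (v∈ T t , v∈ T′ t′)))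
      where
      only-v : ∀ {x} → x ∈ T ∩ T′ → x ∈ ⁅ v ⁆
      only-v {x} x∈ with v ≟ x
      ... | yes refl = x∈⁅x⁆ v
      ... | no v≢x with x∈p∩q⁻ T T′ x∈ | ≢⇒difference T≢T′
      ... | x∈T , x∈T′ | a , inj₁ (a∈ , a∉) = ⊥-elim (share-two t t′ v≢x (v∈ T t) (v∈ T′ t′) x∈T x∈T′ a∈ a∉)
      ... | x∈T , x∈T′ | a , inj₂ (a∈ , a∉) = ⊥-elim (share-two t′ t v≢x (v∈ T′ t′) (v∈ T t) x∈T′ x∈T a∈ a∉)

    Missed : Fin k → Set
    Missed v = ∃ λ T → IsTriangle F T × v ∉ T

    missed? : ∀ v → Dec (Missed v)
    missed? v = anySubset? (λ T → isTriangle? T ×-dec ¬? (v ∈? T))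

    not-missed⇒centre : ∀ {v} → ¬ Missed v → Centre v
    not-missed⇒centre {v} ¬missed = in-all⇒centre λ T t →
      decidable-stable (v ∈? T) λ v∉ → ¬missed (T , t , v∉)

    -- If T₀ and T₁ meet in p and T₂ misses p, then T₂ closes a 4-cycle with them.
    meeting⇒not-missed : PairwiseMeeting → ∀ {T₀ T₁ a p} → IsTriangle F T₀ → IsTriangle F T₁ →
      a ∈ T₀ → a ∉ T₁ → p ∈ T₀ → p ∈ T₁ → ¬ Missed p
    meeting⇒not-missed meet {T₀} {T₁} {a} {p} t₀@(_ , adj₀) t₁@(_ , adj₁)
      a∈ a∉ p∈₀ p∈₁ (T₂ , t₂@(_ , adj₂) , p∉₂)
      with f , f∈₀ , f∈₂ ← meet T₀ T₂ t₀ t₂ | e , e∈₁ , e∈₂ ← meet T₁ T₂ t₁ t₂ | e ∈? T₀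
    -- No third triangle is needed here: `T₀` and `T₁` already share `p` and `e`.
    ... | yes e∈₀ = share-two t₀ t₁ (λ { refl → p∉₂ e∈₂ }) p∈₀ p∈₁ e∈₀ e∈₁ a∈ a∉
    ... | no e∉₀ =
      let g , g∈₀ , g≢p , g≢f = third-vertex t₀ p f in
      no-4-cycle only3
        (adj₁ e p e∈₁ p∈₁ λ { refl → p∉₂ e∈₂ }) (adj₀ p g p∈₀ g∈₀ (g≢p ∘ sym))
        (adj₀ g f g∈₀ f∈₀ g≢f) (adj₂ f e f∈₂ e∈₂ λ { refl → e∉₀ f∈₀ })
        (λ { refl → e∉₀ g∈₀ }) (λ { refl → p∉₂ f∈₂ })

    -- Any corner of a triangle serves unless some triangle misses it; then a common point of these
    -- two triangles lies in all triangles.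
    find-centre : PairwiseMeeting → Fin k → ∃ Centre
    find-centre meet v with anySubset? isTriangle?
    ... | no none = v , λ T _ t → ⊥-elim (none (T , t))
    ... | yes (T , t) with a , _ , _ , (a∈ , _) , _ ← triangle-corners t with missed? a
    ... | no ¬missed = a , not-missed⇒centre ¬missed
    ... | yes (T₁ , t₁ , a∉) = let p , p∈ , p∈₁ = meet T T₁ t t₁ in
      p , not-missed⇒centre (meeting⇒not-missed meet t t₁ a∈ a∉ p∈ p∈₁)

-- Linear growth excludes long cycles and disjoint triangles

linear-bound-fails : ∀ {N d X} → 1 ≤ N → suc X ≤ d → ¬ (N * d ≤ X * N)
linear-bound-fails {N} {d} {X} (s≤s _) X<d Nd≤XN = ℕₚ.<⇒≱ X<d
  (ℕₚ.*-cancelˡ-≤ N (subst (N * d ≤_) (ℕₚ.*-comm X N) Nd≤XN))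

module Lower {k} (F : Graph k) (C n₀ : ℕ) (bound : ∀ n → n₀ ≤ n → rex n K₃ F ≤ C * n) where

  open Triangles F

  -- A cycle of another length would be missing from an orbit graph of larger girth, which would
  -- then be `F`-free with too many triangles.
  triangle-cycles : TriangleCycles
  triangle-cycles {m} c cycle = decidable-stable (suc m ℕ.≟ 3) λ not3 →
    linear-bound-fails (ℕₚ.≤-trans (s≤s z≤n) d≤size) (ℕₚ.m≤m+n (suc (C * 3)) n₀) (begin
      size * d          ≤⟨ many-triangles ⟩
      𝒩 K₃ graph * 3    ≤⟨ ℕₚ.*-monoˡ-≤ 3 (≤-rex F K₃ graph (free not3) regular) ⟩
      rex size K₃ F * 3 ≤⟨ ℕₚ.*-monoˡ-≤ 3 (bound size (ℕₚ.≤-trans (ℕₚ.m≤n+m n₀ _) d≤size)) ⟩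
      C * size * 3      ≡⟨ solve 2 (λ C n → C :* n :* con 3 := C :* con 3 :* n) refl C size ⟩
      C * 3 * size      ∎)
    where
    open +-*-Solver
    open ℕₚ.≤-Reasoning
    -- The first summand beats the constant `C` times the factor 3 of `many-triangles`; the second,
    -- with `d≤size`, puts `size` beyond `n₀`.
    d = suc (C * 3) + n₀
    S = proj₁ (high-girth d (suc m))
    open RotationSystem S using (size)
    open OrbitGraph S {m} (λ {i} → proj₂ (high-girth d (suc m)) {i})
    free : suc m ≢ 3 → Free F graph
    free not3 (φ , φ-inj , φ-hom) = not3 (short-cycles (φ ∘ c) record
      { length≥3 = length≥3 ; injective = injective ∘ φ-inj
      ; step = λ t → φ-hom _ _ (step t) ; close = φ-hom _ _ close } ℕₚ.≤-refl)
      where open IsCycle cycle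

  -- An embedding into the apex graph would send a corner of each triangle to the apex, so disjoint
  -- triangles make that graph `F`-free.
  pairwise-meeting : PairwiseMeeting
  pairwise-meeting T T′ t t′ = decidable-stable (any? (λ x → (x ∈? T) ×-dec (x ∈? T′))) λ disjoint →
    linear-bound-fails {suc p} {p} (s≤s z≤n) (ℕₚ.m≤m+n (suc (C * 9)) n₀) (begin
      suc p * p                   ≤⟨ spokes≤triangles p ⟩
      𝒩 K₃ graph         ≤⟨ ≤-rex F K₃ graph (free disjoint) regular ⟩
      rex n K₃ F                  ≤⟨ bound n n₀≤n ⟩
      -- The vertex number `4p + 5` is padded to `9(p + 1)`, so that `p + 1` cancels against the
      -- number of triangles.
      C * (1 + 2 * (2 * suc p))   ≤⟨ ℕₚ.*-monoʳ-≤ C (ℕₚ.m≤m+n (1 + 2 * (2 * suc p)) (4 + 5 * p)) ⟩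
      C * (1 + 2 * (2 * suc p) + (4 + 5 * p)) ≡⟨ solve 2 (λ C p →
        C :* (con 1 :+ con 2 :* (con 2 :* (con 1 :+ p)) :+ (con 4 :+ con 5 :* p)) :=
        C :* con 9 :* (con 1 :+ p)) refl C p ⟩
      C * 9 * suc p ∎)
    where
    open +-*-Solver
    open ℕₚ.≤-Reasoning
    p = suc (C * 9) + n₀
    n = 1 + 2 * (2 * suc p)
    open Apex (suc p) using (system; centre; triangle-∋-centre)
    open NeighbourSystem system using (graph; regular)
    n₀≤n : n₀ ≤ n
    n₀≤n = begin
      n₀              ≤⟨ ℕₚ.m≤n+m n₀ (suc (C * 9)) ⟩
      p               ≤⟨ ℕₚ.n≤1+n p ⟩
      suc p           ≤⟨ ℕₚ.m≤n*m (suc p) 4 ⟩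
      4 * suc p       ≡⟨ ℕₚ.*-assoc 2 2 (suc p) ⟩
      2 * (2 * suc p) ≤⟨ ℕₚ.n≤1+n _ ⟩
      n ∎
    module _ (φ : Fin k → Fin n) (φ-hom : ∀ i j → Adj F i j → Adj graph (φ i) (φ j)) where
      centre∈ : ∀ {T} → IsTriangle F T → ∃ λ x → x ∈ T × centre ≡ φ x
      centre∈ t with x , y , z , (x∈ , y∈ , z∈) , (xy , yz , xz) ← triangle-corners t
        with triangle-∋-centre (φ-hom x y xy , φ-hom y z yz , φ-hom x z xz)
      ... | inj₁ eq = x , x∈ , eq
      ... | inj₂ (inj₁ eq) = y , y∈ , eq
      ... | inj₂ (inj₂ eq) = z , z∈ , eq
    free : ¬ (∃ λ x → x ∈ T × x ∈ T′) → Free F graph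
    free disjoint (φ , φ-inj , φ-hom) =
      let x , x∈ , x-eq = centre∈ φ φ-hom t
          y , y∈ , y-eq = centre∈ φ φ-hom t′
      in disjoint (x , x∈ , subst (_∈ T′) (φ-inj (trans (sym y-eq) x-eq)) y∈)

linear⇒extendedFriendship : ∀ {k} (F : Graph k) → (λ n → rex n K₃ F) =O id → ExtendedFriendship F
linear⇒extendedFriendship {zero} F (C , n₀ , bound) = record
  { cycle⇒triangle = Lower.triangle-cycles F C n₀ bound ; centre = inj₁ refl }
linear⇒extendedFriendship {suc k} F (C , n₀ , bound) = record
  { cycle⇒triangle = Lower.triangle-cycles F C n₀ bound
  ; centre = inj₂ (Triangles.find-centre F
      (Lower.triangle-cycles F C n₀ bound) (Lower.pairwise-meeting F C n₀ bound) zero) }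

-- Embedding extended friendship graphs

x∉p-x : ∀ {n} (p : Subset n) x → x ∉ p - x
x∉p-x (_ ∷ p) (suc x) (there x∈) = x∉p-x p x x∈

∈-minus⁻ : ∀ {n} {p : Subset n} {x y} → y ∈ p - x → y ∈ p × y ≢ x
∈-minus⁻ {p = p} {x} y∈ = p─q⊆p p ⁅ x ⁆ y∈ , λ { refl → x∉p-x p x y∈ }

fromList : ∀ {n} → List (Fin n) → Subset n
fromList xs = tabulate (λ x → does (x ∈ₗ? xs))

∣fromList∣≤length : ∀ {n} (xs : List (Fin n)) → ∣ fromList xs ∣ ≤ length xs
∣fromList∣≤length xs = subst (_≤ length xs) (length-elements (fromList xs))
  (unique⊆⇒length≤ (elements-unique (fromList xs)) λ x∈ → ∈-tabulate⁻ (_∈ₗ? xs) (∈-elements⁻ x∈))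

-- The friendship condition expressed by cycles alone, with the centre in every one of them.
Through : ∀ {k} → Graph k → Fin k → Set
Through {k} F v = ∀ {m} (c : Fin (suc m) → Fin k) → IsCycle F c → suc m ≡ 3 × ∃ λ t → c t ≡ v

module _ {k} {F : Graph k} (friendship : ExtendedFriendship F) where

  open ExtendedFriendship friendship
  open Triangles F

  3-cycle⇒triangle : ∀ (c : Fin 3 → Fin k) → IsCycle F c → IsTriangle F (tabulate (does ∘ vertexOf? c))
  3-cycle⇒triangle c cycle =
    ∣p∣≡size-of-enumeration c injective (λ i → ∈-tabulate⁺ (vertexOf? c) (i , refl)) (∈-tabulate⁻ (vertexOf? c))
    , λ x y x∈ y∈ → adjacent (∈-tabulate⁻ (vertexOf? c) x∈) (∈-tabulate⁻ (vertexOf? c) y∈)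
    where
    open IsCycle cycle
    corner-adj : ∀ i j → c i ≢ c j → Adj F (c i) (c j)
    corner-adj zero zero ≢ = ⊥-elim (≢ refl)
    corner-adj zero (suc zero) _ = step zero
    corner-adj zero (suc (suc zero)) _ = adj-sym F close
    corner-adj (suc zero) zero _ = adj-sym F (step zero)
    corner-adj (suc zero) (suc zero) ≢ = ⊥-elim (≢ refl)
    corner-adj (suc zero) (suc (suc zero)) _ = step (suc zero)
    corner-adj (suc (suc zero)) zero _ = close
    corner-adj (suc (suc zero)) (suc zero) _ = adj-sym F (step (suc zero))
    corner-adj (suc (suc zero)) (suc (suc zero)) ≢ = ⊥-elim (≢ refl)
    adjacent : ∀ {x y} → (∃ λ i → c i ≡ x) → (∃ λ i → c i ≡ y) → x ≢ y → Adj F x y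
    adjacent (i , refl) (j , refl) = corner-adj i j

  in-all⇒through : ∀ {v} → (∀ T → IsTriangle F T → v ∈ T) → Through F v
  in-all⇒through v∈ c cycle with refl ← cycle⇒triangle c cycle =
    refl , ∈-tabulate⁻ (vertexOf? c) (v∈ _ (3-cycle⇒triangle c cycle))

  -- A centre missed by a triangle T can be replaced by any corner of T, since T
  -- is then the only triangle.
  common-vertex : Fin k → ∃ (Through F)
  common-vertex x with centre
  ... | inj₁ refl with () ← x
  ... | inj₂ (v , v-centre) with anySubset? (λ T → isTriangle? T ×-dec ¬? (v ∈? T))
  ... | no ¬missed = v , in-all⇒through λ T t → decidable-stable (v ∈? T) λ v∉ → ¬missed (T , t , v∉)
  ... | yes (T , t , v∉) with u , _ , _ , (u∈ , _) , _ ← triangle-corners t =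
    u , in-all⇒through λ T′ t′ → decidable-stable (u ∈? T′) λ u∉ →
      v∉ (proj₁ (x∈p∩q⁻ T T′ (subst (v ∈_)
        (sym (v-centre T T′ t t′ λ { refl → u∉ u∈ })) (x∈⁅x⁆ v))))

-- Finding a leaf or a pendant triangle

module _ {k} (F : Graph k) {v} (through : Through F v) (U : Subset k) where

  record Path {m} (c : Fin (suc m) → Fin k) : Set where
    field
      injective : Injective _≡_ _≡_ c
      step      : ∀ (t : Fin m) → Adj F (c (inject₁ t)) (c (suc t))
      inside    : ∀ t → c t ∈ U × c t ≢ v

  open Path

  Stuck : ∀ {m} → (Fin (suc m) → Fin k) → Set
  Stuck c = ∀ {y} → y ∈ U → y ≢ v → Adj F (c zero) y → ∃ λ t → c t ≡ y

  -- The path is extended at its front, so its last vertex stays. The fuel suffices because a path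
  -- has at most `k` vertices.
  grow : ∀ f {m} (c : Fin (suc m) → Fin k) → Path c → k ≤ m + f →
    ∃ λ m′ → Σ (Fin (suc m′) → Fin k) λ c′ → Path c′ × Stuck c′ × c′ (fromℕ m′) ≡ c (fromℕ m)
  grow zero {m} c path k≤m = ⊥-elim (ℕₚ.<⇒≱ (injective⇒≤ (injective path)) (subst (k ≤_) (ℕₚ.+-identityʳ m) k≤m))
  grow (suc f) {m} c path k≤m+f
    with any? (λ y → (y ∈? U) ×-dec ¬? (y ≟ v) ×-dec adj? F (c zero) y ×-dec ¬? (any? (λ t → c t ≟ y)))
  ... | no none = m , c , path , (λ {y} y∈ y≢v cy → decidable-stable (any? (λ t → c t ≟ y))
    λ y∉ → none (y , y∈ , y≢v , cy , y∉)) , refl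
  ... | yes (y , y∈ , y≢v , cy , y∉c) = grow f (y ◃ c) record
    { injective = ◃-injective (λ t eq → y∉c (t , sym eq)) (injective path)
    ; step = λ { zero → adj-sym F cy ; (suc t) → step path t }
    ; inside = λ { zero → y∈ , y≢v ; (suc t) → inside path t } }
    (subst (k ≤_) (ℕₚ.+-suc m f) k≤m+f)

  -- The chord would close an initial segment of the path to a cycle avoiding `v`.
  no-chord : ∀ {m} {c : Fin (suc m) → Fin k} → Path c → ∀ t → 2 ≤ toℕ t → ¬ Adj F (c t) (c zero)
  no-chord {m} {c} path t 2≤t chord =
    let _ , s , s≡v = through prefix record
          { length≥3 = s≤s 2≤t
          ; injective = λ eq → inject≤-injective _ _ _ _ (injective path eq)
          ; step = λ s → subst (λ u → Adj F u (prefix (suc s))) (cong c (inject≤-inject₁ s))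
              (step path (inject≤ s (ℕ.s≤s⁻¹ (toℕ<n t))))
          ; close = subst (λ u → Adj F (c u) (c zero)) (sym last≡t) chord }
    in proj₂ (inside path _) s≡v
    where
    prefix : Fin (suc (toℕ t)) → Fin k
    prefix s = c (inject≤ s (toℕ<n t))
    inject≤-inject₁ : ∀ s → inject₁ (inject≤ s (ℕ.s≤s⁻¹ (toℕ<n t))) ≡ inject≤ (inject₁ s) (toℕ<n t)
    inject≤-inject₁ s = toℕ-injective (trans (toℕ-inject₁ _) (trans (toℕ-inject≤ s _)
      (sym (trans (toℕ-inject≤ (inject₁ s) _) (toℕ-inject₁ s)))))
    last≡t : inject≤ (fromℕ (toℕ t)) (toℕ<n t) ≡ t
    last≡t = toℕ-injective (trans (toℕ-inject≤ (fromℕ (toℕ t)) _) (toℕ-fromℕ (toℕ t)))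

  EndsAt : Fin k → Fin k → Set
  EndsAt p q = ∀ {y} → y ∈ U → Adj F p y → y ≡ v ⊎ y ≡ q

  stuck⇒endsAt : ∀ {m} {c : Fin (suc (suc m)) → Fin k} → Path c → Stuck c → EndsAt (c zero) (c (suc zero))
  stuck⇒endsAt {c = c} path stuck {y} y∈ cy with y ≟ v
  ... | yes y≡v = inj₁ y≡v
  ... | no y≢v with stuck y∈ y≢v cy
  ... | zero , refl = ⊥-elim (adj-irr F cy refl)
  ... | suc zero , refl = inj₂ refl
  ... | suc (suc t) , refl = ⊥-elim (no-chord path (suc (suc t)) (s≤s (s≤s z≤n)) (adj-sym F cy))

  single-stuck⇒endsAt : ∀ {c : Fin 1 → Fin k} → Path c → Stuck c → EndsAt (c zero) v
  single-stuck⇒endsAt path stuck {y} y∈ cy with y ≟ v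
  ... | yes y≡v = inj₁ y≡v
  ... | no y≢v with zero , refl ← stuck y∈ y≢v cy = ⊥-elim (adj-irr F cy refl)

  -- Only upper bounds on neighbourhoods inside `U` are recorded: the images will be given every
  -- adjacency that these bounds allow.
  data Removable : Set where
    leaf    : ∀ w u → w ∈ U → w ≢ v → u ∈ U → u ≢ w → (∀ {y} → y ∈ U → Adj F w y → y ≡ u) → Removable
    pendant : ∀ p q → p ∈ U → p ≢ v → q ∈ U → q ≢ v → p ≢ q → EndsAt p q → EndsAt q p → Removable

  module _ (v∈U : v ∈ U) where

    end⇒leaf : ∀ {p} → p ∈ U → p ≢ v → EndsAt p v → Removable
    end⇒leaf p∈ p≢v ends = leaf _ v p∈ p≢v v∈U (p≢v ∘ sym) λ y∈ py → [ id , id ]′ (ends y∈ py)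

    leaf-or-joined : ∀ {p q} → p ∈ U → p ≢ v → q ∈ U → q ≢ p → EndsAt p q → Removable ⊎ Adj F p v
    leaf-or-joined {p} {q} p∈ p≢v q∈ q≢p ends with adj? F p v
    ... | yes pv = inj₂ pv
    ... | no ¬pv = inj₁ (leaf p q p∈ p≢v q∈ q≢p λ y∈ py →
      [ (λ { refl → ⊥-elim (¬pv py) }) , id ]′ (ends y∈ py))

    start : ∀ {w} → w ∈ U → w ≢ v → Path (λ (_ : Fin 1) → w)
    start w∈ w≢v = record { injective = λ { {zero} {zero} _ → refl } ; step = λ () ; inside = λ _ → w∈ , w≢v }

    -- Follow a path in U ∖ {v} to a dead end p, then a second one from p to a
    -- dead end q.  If both are joined to v, the second path closes to a cycle
    -- through v, which has to be a triangle.
    removable : ∀ {w} → w ∈ U → w ≢ v → Removable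
    removable w∈ w≢v with grow k _ (start w∈ w≢v) ℕₚ.≤-refl
    ... | zero , c , path , stuck , _ =
      end⇒leaf (proj₁ (inside path zero)) (proj₂ (inside path zero)) (single-stuck⇒endsAt path stuck)
    ... | suc m , c , path , stuck , _
      with p∈ , p≢v ← inside path zero | p-ends ← stuck⇒endsAt path stuck
      with leaf-or-joined p∈ p≢v (proj₁ (inside path (suc zero))) (λ eq → 0≢1+n (sym (injective path eq))) p-ends
    ... | inj₁ found = found
    ... | inj₂ pv with grow k _ (start p∈ p≢v) ℕₚ.≤-refl
    ... | zero , d , path′ , stuck′ , _ =
      end⇒leaf (proj₁ (inside path′ zero)) (proj₂ (inside path′ zero)) (single-stuck⇒endsAt path′ stuck′)
    ... | suc m′ , d , path′ , stuck′ , last≡p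
      with q∈ , q≢v ← inside path′ zero | q-ends ← stuck⇒endsAt path′ stuck′
      with leaf-or-joined q∈ q≢v (proj₁ (inside path′ (suc zero))) (λ eq → 0≢1+n (sym (injective path′ eq))) q-ends
    ... | inj₁ found = found
    ... | inj₂ qv with through (v ◃ d) record
           { length≥3 = s≤s (s≤s (s≤s z≤n))
           ; injective = ◃-injective (λ t eq → proj₂ (inside path′ t) (sym eq)) (injective path′)
           ; step = λ { zero → adj-sym F qv ; (suc t) → step path′ t }
           ; close = subst (λ x → Adj F x v) (sym last≡p) pv }
    -- Length 3 leaves just `q` and `p` on the second path, so they are adjacent, and `p-ends`
    -- identifies `q` with the second vertex of the first path.
    ... | refl , _ = triangle-found last≡p (p-ends q∈ pq)
      where
      pq : Adj F (c zero) (d zero)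
      pq = subst (λ x → Adj F x (d zero)) last≡p (adj-sym F (step path′ zero))
      triangle-found : d (suc zero) ≡ c zero → d zero ≡ v ⊎ d zero ≡ c (suc zero) → Removable
      triangle-found _ (inj₁ q≡v) = ⊥-elim (q≢v q≡v)
      triangle-found d₁≡p (inj₂ q≡c₁) = pendant (c zero) (d zero) p∈ p≢v q∈ q≢v (adj-irr F pq)
        (subst (EndsAt (c zero)) (sym q≡c₁) p-ends)
        (subst (EndsAt (d zero)) d₁≡p q-ends)

-- Embedding with the centre at a prescribed vertex

module Embed {k n} (F : Graph k) {v} (through : Through F v) (G : Graph n) (x₀ : Fin n)
  (large-degree : ∀ x → k < degree G x)
  (escape : ∀ xs → length xs ≤ k → ∃ λ y → ∃ λ z → Triangle G x₀ y z × y ∉ₗ xs × z ∉ₗ xs) where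

  -- `φ` is total, but distinctness and adjacency are only required on `U`.
  record PartialEmbedding (U : Subset k) : Set where
    field
      φ       : Fin k → Fin n
      φv≡x₀   : φ v ≡ x₀
      inj     : ∀ {i j} → i ∈ U → j ∈ U → φ i ≡ φ j → i ≡ j
      hom     : ∀ {i j} → i ∈ U → j ∈ U → Adj F i j → Adj G (φ i) (φ j)

    used : List (Fin n)
    used = map φ (elements U)

    length-used : length used ≡ ∣ U ∣
    length-used = trans (length-map φ (elements U)) (length-elements U)

    ∈-used : ∀ {i} → i ∈ U → φ i ∈ₗ used
    ∈-used i∈ = ∈-map⁺ φ (∈-elements⁺ i∈)

  open PartialEmbedding

  extend : ∀ {U w} (e : PartialEmbedding (U - w)) → w ≢ v → ∀ y → y ∉ₗ used e →
    (∀ {u} → u ∈ U - w → Adj F w u → Adj G y (φ e u)) →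
    Σ (PartialEmbedding U) λ e′ → φ e′ w ≡ y × (∀ {i} → i ≢ w → φ e′ i ≡ φ e i)
  extend {U} {w} e w≢v y fresh y-adj = record
    { φ = ψ
    ; φv≡x₀ = trans (ψ-old (w≢v ∘ sym)) (φv≡x₀ e)
    ; inj = ψ-inj
    ; hom = ψ-hom } , ψ-new , ψ-old
    where
    ψ : Fin k → Fin n
    ψ i with i ≟ w
    ... | yes _ = y
    ... | no _ = φ e i
    ψ-new : ψ w ≡ y
    ψ-new with w ≟ w
    ... | yes _ = refl
    ... | no w≢w = ⊥-elim (w≢w refl)
    ψ-old : ∀ {i} → i ≢ w → ψ i ≡ φ e i
    ψ-old {i} i≢w with i ≟ w
    ... | yes i≡w = ⊥-elim (i≢w i≡w)
    ... | no _ = refl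
    ψ-inj : ∀ {i j} → i ∈ U → j ∈ U → ψ i ≡ ψ j → i ≡ j
    ψ-inj {i} {j} i∈ j∈ eq with i ≟ w | j ≟ w
    ... | yes refl | yes refl = refl
    ... | yes refl | no j≢w = ⊥-elim (fresh (subst (_∈ₗ used e) (sym eq) (∈-used e (x∈p∧x≢y⇒x∈p-y j∈ j≢w))))
    ... | no i≢w | yes refl = ⊥-elim (fresh (subst (_∈ₗ used e) eq (∈-used e (x∈p∧x≢y⇒x∈p-y i∈ i≢w))))
    ... | no i≢w | no j≢w = inj e (x∈p∧x≢y⇒x∈p-y i∈ i≢w) (x∈p∧x≢y⇒x∈p-y j∈ j≢w) eq
    ψ-hom : ∀ {i j} → i ∈ U → j ∈ U → Adj F i j → Adj G (ψ i) (ψ j)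
    ψ-hom {i} {j} i∈ j∈ ij with i ≟ w | j ≟ w
    ... | yes refl | yes refl = ⊥-elim (adj-irr F ij refl)
    ... | yes refl | no j≢w = y-adj (x∈p∧x≢y⇒x∈p-y j∈ j≢w) ij
    ... | no i≢w | yes refl = adj-sym G (y-adj (x∈p∧x≢y⇒x∈p-y i∈ i≢w) (adj-sym F ij))
    ... | no i≢w | no j≢w = hom e (x∈p∧x≢y⇒x∈p-y i∈ i≢w) (x∈p∧x≢y⇒x∈p-y j∈ j≢w) ij

  -- The image of `u` has more than `k` neighbours, and fewer than `k` vertices are in use, so a
  -- free neighbour remains for `w`.
  extend-leaf : ∀ {U w u} → (e : PartialEmbedding (U - w)) → w ∈ U → w ≢ v → u ∈ U → u ≢ w →
    (∀ {y} → y ∈ U → Adj F w y → y ≡ u) → PartialEmbedding U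
  extend-leaf {U} {w} {u} e w∈ w≢v u∈ u≢w only-u =
    let y , y∈ , fresh = larger⇒escapes (neighbours G (φ e u)) (used e) (ℕₚ.<-≤-trans
          (subst (_< ∣ U ∣) (sym (length-used e)) (x∈p⇒∣p-x∣<∣p∣ w∈))
          (ℕₚ.≤-trans (∣p∣≤n U) (ℕₚ.<⇒≤ (large-degree (φ e u)))))
    in proj₁ (extend e w≢v y fresh λ {u′} u′∈ wu′ →
      subst (λ t → Adj G y (φ e t)) (sym (only-u (proj₁ (∈-minus⁻ u′∈)) wu′)) (adj-sym G y∈))

  -- A triangle at `x₀` avoiding the used vertices receives `q` and then `p`; the image of `p` is
  -- still fresh in the second step because it is adjacent to that of `q`.
  extend-pendant : ∀ {U p q} → (e : PartialEmbedding (U - p - q)) → p ≢ v → q ≢ v → p ≢ q →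
    EndsAt F through U p q → EndsAt F through U q p → PartialEmbedding U
  extend-pendant {U} {p} {q} e p≢v q≢v p≢q p-ends q-ends =
    let y , z , (x₀y , yz , x₀z) , y-fresh , z-fresh =
          escape (used e) (subst (_≤ k) (sym (length-used e)) (∣p∣≤n (U - p - q)))
        e′ , q↦z , old = extend {U - p} {q} e q≢v z z-fresh λ u∈ qu → z-adj x₀z u∈ qu
    in proj₁ (extend {U} {p} e′ p≢v y (y-fresh′ e′ yz q↦z old y-fresh) λ u∈ pu → y-adj e′ x₀y yz q↦z u∈ pu)
    where
    z-adj : ∀ {z u} → Adj G x₀ z → u ∈ U - p - q → Adj F q u → Adj G z (φ e u)
    z-adj x₀z u∈ qu with u∈U-p , _ ← ∈-minus⁻ u∈ with u∈U , u≢p ← ∈-minus⁻ u∈U-p with q-ends u∈U qu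
    ... | inj₁ refl = subst (Adj G _) (sym (φv≡x₀ e)) (adj-sym G x₀z)
    ... | inj₂ u≡p = ⊥-elim (u≢p u≡p)
    y-adj : ∀ (e′ : PartialEmbedding (U - p)) {y z u} → Adj G x₀ y → Adj G y z → φ e′ q ≡ z →
      u ∈ U - p → Adj F p u → Adj G y (φ e′ u)
    y-adj e′ x₀y yz q↦z u∈ pu with p-ends (proj₁ (∈-minus⁻ u∈)) pu
    ... | inj₁ refl = subst (Adj G _) (sym (φv≡x₀ e′)) (adj-sym G x₀y)
    ... | inj₂ refl = subst (Adj G _) (sym q↦z) yz
    y-fresh′ : ∀ (e′ : PartialEmbedding (U - p)) {y z} → Adj G y z → φ e′ q ≡ z →
      (∀ {i} → i ≢ q → φ e′ i ≡ φ e i) → y ∉ₗ used e → y ∉ₗ used e′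
    y-fresh′ e′ yz q↦z old y-fresh y∈ with i , i∈ , refl ← ∈-map⁻ (φ e′) y∈ with i ≟ q
    ... | yes refl = adj-irr G yz q↦z
    ... | no i≢q = y-fresh (subst (_∈ₗ used e) (sym (old i≢q)) (∈-used e (x∈p∧x≢y⇒x∈p-y (∈-elements⁻ i∈) i≢q)))

  -- Induction on the size of `U`, strictly bounded by `s`: a removable part is taken off, the rest
  -- embedded and the part put back.
  partial-embedding : ∀ s U → ∣ U ∣ < s → v ∈ U → PartialEmbedding U
  partial-embedding (suc s) U (s≤s ∣U∣≤s) v∈ with any? (λ w → (w ∈? U) ×-dec ¬? (w ≟ v))
  ... | no none = record
    { φ = λ _ → x₀ ; φv≡x₀ = refl
    ; inj = λ i∈ j∈ _ → trans (only-v i∈) (sym (only-v j∈))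
    ; hom = λ i∈ j∈ ij → ⊥-elim (adj-irr F ij (trans (only-v i∈) (sym (only-v j∈)))) }
    where
    only-v : ∀ {i} → i ∈ U → i ≡ v
    only-v {i} i∈ = decidable-stable (i ≟ v) λ i≢v → none (i , i∈ , i≢v)
  ... | yes (w , w∈ , w≢v) with removable F through U v∈ w∈ w≢v
  ... | leaf w u w∈ w≢v u∈ u≢w only-u = extend-leaf
    (partial-embedding s (U - w) (ℕₚ.<-≤-trans (x∈p⇒∣p-x∣<∣p∣ w∈) ∣U∣≤s) (x∈p∧x≢y⇒x∈p-y v∈ (w≢v ∘ sym)))
    w∈ w≢v u∈ u≢w only-u
  ... | pendant p q p∈ p≢v q∈ q≢v p≢q p-ends q-ends = extend-pendant
    (partial-embedding s (U - p - q)
      (ℕₚ.≤-<-trans (∣p─q∣≤∣p∣ (U - p) ⁅ q ⁆) (ℕₚ.<-≤-trans (x∈p⇒∣p-x∣<∣p∣ p∈) ∣U∣≤s))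
      (x∈p∧x≢y⇒x∈p-y (x∈p∧x≢y⇒x∈p-y v∈ (p≢v ∘ sym)) (q≢v ∘ sym)))
    p≢v q≢v p≢q p-ends q-ends

  embeds : Contains F G
  embeds = let e = partial-embedding (suc ∣ full {k} ∣) (full {k}) ℕₚ.≤-refl ∈⊤ in
    φ e , inj e ∈⊤ ∈⊤ , λ i j → hom e ∈⊤ ∈⊤

-- Small covers of links and the linear upper bound

module _ {n} (G : Graph n) where

  Covers : Fin n → Subset n → Set
  Covers x S = ∀ y z → Triangle G x y z → y ∈ S ⊎ z ∈ S

  SmallCover : ℕ → Fin n → Set
  SmallCover s x = ∃ λ S → ∣ S ∣ ≤ s × Covers x S

  triangle? : ∀ x y z → Dec (Triangle G x y z)
  triangle? x y z = adj? G x y ×-dec adj? G y z ×-dec adj? G x z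

  smallCover? : ∀ s x → Dec (SmallCover s x)
  smallCover? s x = anySubset? λ S → (∣ S ∣ ℕ.≤? s) ×-dec
    all? (λ y → all? (λ z → triangle? x y z →-dec ((y ∈? S) ⊎-dec (z ∈? S))))

  -- If no triangle at `x` avoided `xs`, then `xs` would itself be a small cover.
  no-small-cover⇒escape : ∀ {s x} → ¬ SmallCover s x → ∀ xs → length xs ≤ s →
    ∃ λ y → ∃ λ z → Triangle G x y z × y ∉ₗ xs × z ∉ₗ xs
  no-small-cover⇒escape {s} {x} none xs xs≤s = decidable-stable
    (any? λ y → any? λ z → triangle? x y z ×-dec ¬? (y ∈ₗ? xs) ×-dec ¬? (z ∈ₗ? xs))
    λ stuck → none (fromList xs , ℕₚ.≤-trans (∣fromList∣≤length xs) xs≤s , λ y z t → covered stuck y z t)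
    where
    covered : ¬ (∃ λ y → ∃ λ z → Triangle G x y z × y ∉ₗ xs × z ∉ₗ xs) → Covers x (fromList xs)
    covered stuck y z t with y ∈ₗ? xs | z ∈ₗ? xs
    ... | yes y∈ | _ = inj₁ (∈-tabulate⁺ (_∈ₗ? xs) y∈)
    ... | _ | yes z∈ = inj₂ (∈-tabulate⁺ (_∈ₗ? xs) z∈)
    ... | no y∉ | no z∉ = ⊥-elim (stuck (y , z , t , y∉ , z∉))

  -- The neighbourhood of `x` covers its own link.
  no-small-cover⇒degree : ∀ {s x} → ¬ SmallCover s x → s < degree G x
  no-small-cover⇒degree {s} {x} none = ℕₚ.≰⇒> λ deg≤s →
    none (neighbours G x , deg≤s , λ y z (xy , _) → inj₁ xy)

  small-covers⇒few-triangles : ∀ {s} → (∀ x → SmallCover s x) → 𝒩 K₃ G ≤ n * (s * s)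
  small-covers⇒few-triangles {s} cover = triangles≤cover² G (λ x → elements (proj₁ (cover x)))
    (λ x → subst (_≤ s) (sym (length-elements (proj₁ (cover x)))) (proj₁ (proj₂ (cover x))))
    λ {x} {y} {z} t → Data.Sum.map ∈-elements⁺ ∈-elements⁺ (proj₂ (proj₂ (cover x)) y z t)

free⇒few-triangles : ∀ {k} (F : Graph k) → ExtendedFriendship F → ∀ {n} (G : Graph n) →
  Free F G → Regular G → 𝒩 K₃ G ≤ n * (k * k)
-- The graph without vertices embeds in every graph.
free⇒few-triangles {zero} F _ G free _ = ⊥-elim (free ((λ ()) , (λ {}) , λ ()))
free⇒few-triangles {k@(suc _)} F friendship G free regular = small-covers⇒few-triangles G λ x →
  decidable-stable (smallCover? G k x) λ none →
    let v , through = common-vertex friendship zero in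
    free (Embed.embeds F through G x
      -- Regularity carries the large degree from `x` to every vertex.
      (λ y → subst (k <_) (regular x y) (no-small-cover⇒degree G none))
      (no-small-cover⇒escape G none))

extendedFriendship⇒linear : ∀ {k} (F : Graph k) → ExtendedFriendship F → (λ n → rex n K₃ F) =O id
extendedFriendship⇒linear {k} F friendship = k * k , 0 , λ n _ →
  subst (rex n K₃ F ≤_) (ℕₚ.*-comm n (k * k))
    (rex-≤ F K₃ n (λ G → free⇒few-triangles F friendship G))

theorem1p3 : ∀ {k : ℕ} (F : Graph k) →
    ((λ n → rex n K₃ F) =O id) ⇔ ExtendedFriendship F
theorem1p3 F = mk⇔ (linear⇒extendedFriendship F) (extendedFriendship⇒linear F)
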